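{- For a nonzero integer $n$ let $B_n=\sup\{|S\cap(n^2,|n|^3)| : S \text{ has the property } D(n)\}$, where $(n^2,|n|^3)$ is the open interval. For all nonzero integers $n$, $B_n<0.6114\,\log|n|+2.158$. If $|n|>400$, then $B_n<0.6071\,\log|n|+2.152$.
   Context: For a nonzero integer $n$, a set of $m$ (distinct) positive integers $S=\{a_1,a_2,\ldots,a_m\}$ is said to have the property $D(n)$ if $a_ia_j+n$ is a perfect square (the square of an integer, $0$ allowed) for all $1\leq i<j\leq m$. The supremum defining $B_n$ is over all sets $S$ of positive integers with the property $D(n)$, of any size $m$. Here $\log$ denotes the natural logarithm. For $|n|=1$ the interval $(n^2,|n|^3)$ is empty. -}

module Defs where

open import Data.Nat as ℕ using (ℕ; zero; suc; z≤n; s≤s)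
import Data.Nat.Properties as ℕₚ
open import Data.Integer as ℤ using (ℤ; +_; -[1+_])
import Data.Integer.Properties as ℤₚ
open import Data.Rational as ℚ using (ℚ; mkℚ; _/_; 0ℚ; 1ℚ)
import Data.Rational.Properties as ℚₚ
import Data.Rational.Unnormalised as ℚᵘ
import Data.Rational.Unnormalised.Properties as ℚᵘₚ
import Data.Integer.Solver as ℤ-Solver
open import Data.Rational.Solver using (module +-*-Solver)
open import Data.List using (List; []; _∷_; _++_; length; map; filter; upTo)
open import Data.List.Extrema.Nat using (max; xs≤max; max≤v⁺)
open import Data.List.Membership.Propositional using (_∈_)
open import Data.List.Membership.Propositional.Properties
  using (∈-filter⁺; ∈-filter⁻; ∈-map⁺; ∈-++⁺ˡ; ∈-++⁺ʳ; ∈-upTo⁺)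
open import Data.List.Membership.Propositional.Properties.WithK
  using (unique∧set⇒bag)
open import Data.List.Membership.DecPropositional ℕ._≟_ using (_∈?_)
open import Data.List.Relation.Binary.BagAndSetEquality using (∼bag⇒↭)
open import Data.List.Relation.Binary.Permutation.Propositional.Properties
  using (↭-length)
open import Data.List.Relation.Unary.All as All using (All; []; _∷_; all?)
import Data.List.Relation.Unary.All.Properties as Allₚ
open import Data.List.Relation.Unary.AllPairs using (AllPairs; []; _∷_; allPairs?)
open import Data.List.Relation.Unary.Any using (here; there)
open import Data.List.Relation.Unary.Unique.Propositional using (Unique)
open import Data.List.Relation.Unary.Unique.DecPropositional ℕ._≟_ using (unique?)
import Data.List.Relation.Unary.Unique.Propositional.Properties as Uniqueₚ
open import Data.Product using (∃; _×_; _,_; proj₁; proj₂)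
open import Data.Sum using (inj₁; inj₂)
open import Function using (_∘_; mk⇔)
open import Relation.Nullary using (yes; no; contradiction)
open import Relation.Nullary.Decidable using (map′; _×-dec_)
open import Relation.Unary using (Decidable)
open import Relation.Binary.PropositionalEquality

IsSquare : ℤ → Set
IsSquare z = ∃ λ (r : ℤ) → z ≡ r ℤ.* r

-- A finite set of positive integers is a list without repetitions.
record HasD (n : ℤ) (S : List ℕ) : Set where
  constructor mkHasD
  field
    distinct : Unique S
    positive : All (0 ℕ.<_) S
    squares  : AllPairs (λ a b → IsSquare (+ a ℤ.* + b ℤ.+ n)) S

InInterval : ℤ → ℕ → Set
InInterval n a = ℤ.∣ n ∣ ℕ.^ 2 ℕ.< a × a ℕ.< ℤ.∣ n ∣ ℕ.^ 3

inInterval? : ∀ n → Decidable (InInterval n)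
inInterval? n a = (_ ℕ.<? a) ×-dec (a ℕ.<? _)

-- |S ∩ (n², |n|³)|
count : ℤ → List ℕ → ℕ
count n S = length (filter (inInterval? n) S)

record IsSup (P : ℕ → Set) (s : ℕ) : Set where
  constructor mkIsSup
  field
    upper : ∀ {k} → P k → k ℕ.≤ s
    least : ∀ {u} → (∀ {k} → P k → k ℕ.≤ u) → s ℕ.≤ u

Counts : ℤ → ℕ → Set
Counts n k = ∃ λ S → HasD n S × k ≡ count n S

-- sup-exists below: every S may be replaced by its
-- intersection with {0, …, |n|³ - 1}, and there are finitely many of those.

isSquare? : Decidable IsSquare
isSquare? -[1+ m ] = no λ where
  (+ zero  , ())
  (+ suc r , ())
  (-[1+ r ] , ())
isSquare? (+ m) = map′ to from (ℕₚ.anyUpTo? (λ r → m ℕ.≟ r ℕ.* r) (suc m))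
  where
  to : (∃ λ r → r ℕ.< suc m × m ≡ r ℕ.* r) → IsSquare (+ m)
  to (r , _ , eq) = + r , trans (cong +_ eq) (ℤₚ.pos-* r r)
  r≤r² : ∀ r → r ℕ.≤ r ℕ.* r
  r≤r² zero    = z≤n
  r≤r² (suc r) = ℕₚ.m≤m*n (suc r) (suc r)
  from : IsSquare (+ m) → ∃ λ r → r ℕ.< suc m × m ≡ r ℕ.* r
  from (r , eq) = ℤ.∣ r ∣ , s≤s (subst (ℤ.∣ r ∣ ℕ.≤_) (sym eq′) (r≤r² ℤ.∣ r ∣)) , eq′
    where
    eq′ : m ≡ ℤ.∣ r ∣ ℕ.* ℤ.∣ r ∣
    eq′ = trans (cong ℤ.∣_∣ eq) (ℤₚ.abs-* r r)

hasD? : ∀ n → Decidable (HasD n)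
hasD? n S = map′ (λ (u , p , s) → mkHasD u p s)
  (λ (mkHasD u p s) → u , p , s)
  (unique? S ×-dec all? (0 ℕ.<?_) S ×-dec allPairs? (λ a b → isSquare? _) S)

subsets : ∀ {A : Set} → List A → List (List A)
subsets []       = [] ∷ []
subsets (x ∷ xs) = subsets xs ++ map (x ∷_) (subsets xs)

filter∈subsets : ∀ {A : Set} {P : A → Set} (P? : Decidable P) xs →
                 filter P? xs ∈ subsets xs
filter∈subsets P? []       = here refl
filter∈subsets P? (x ∷ xs) with P? x
... | yes _ = ∈-++⁺ʳ (subsets xs) (∈-map⁺ (x ∷_) (filter∈subsets P? xs))
... | no  _ = ∈-++⁺ˡ (filter∈subsets P? xs)

module _ {A : Set} {R : A → A → Set} where

  allPairs⁺ : ∀ {xs} → Unique xs →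
              (∀ {a b} → a ∈ xs → b ∈ xs → a ≢ b → R a b) → AllPairs R xs
  allPairs⁺ []       f = []
  allPairs⁺ (x∉ ∷ u) f =
    All.tabulate (λ b∈ → f (here refl) (there b∈) (All.lookup x∉ b∈))
    ∷ allPairs⁺ u (λ a∈ b∈ → f (there a∈) (there b∈))

  allPairs⁻ : ∀ {xs} → (∀ {a b} → R a b → R b a) → AllPairs R xs →
              ∀ {a b} → a ∈ xs → b ∈ xs → a ≢ b → R a b
  allPairs⁻ s (p ∷ ps) (here refl) (here refl) a≢b = contradiction refl a≢b
  allPairs⁻ s (p ∷ ps) (here refl) (there b∈)  a≢b = All.lookup p b∈
  allPairs⁻ s (p ∷ ps) (there a∈)  (here refl) a≢b = s (All.lookup p a∈)
  allPairs⁻ s (p ∷ ps) (there a∈)  (there b∈)  a≢b = allPairs⁻ s ps a∈ b∈ a≢b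

module _ (n : ℤ) where

  private
    bound : ℕ
    bound = ℤ.∣ n ∣ ℕ.^ 3

  restrict : List ℕ → List ℕ
  restrict S = filter (_∈? S) (upTo bound)

  restrict-HasD : ∀ {S} → HasD n S → HasD n (restrict S)
  restrict-HasD {S} (mkHasD u p s) = mkHasD u′
    (All.tabulate (All.lookup p ∘ ∈S))
    (allPairs⁺ u′ λ a∈ b∈ → allPairs⁻ (λ {a} {b} → swap a b) s (∈S a∈) (∈S b∈))
    where
    u′ : Unique (restrict S)
    u′ = Uniqueₚ.filter⁺ (_∈? S) (Uniqueₚ.upTo⁺ bound)
    ∈S : ∀ {a} → a ∈ restrict S → a ∈ S
    ∈S = proj₂ ∘ ∈-filter⁻ (_∈? S) {xs = upTo bound}
    swap : ∀ a b → IsSquare (+ a ℤ.* + b ℤ.+ n) → IsSquare (+ b ℤ.* + a ℤ.+ n)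
    swap a b = subst (λ z → IsSquare (z ℤ.+ n)) (ℤₚ.*-comm (+ a) (+ b))

  restrict-count : ∀ {S} → HasD n S → count n S ≡ count n (restrict S)
  restrict-count {S} d@(mkHasD u _ _) = ↭-length (∼bag⇒↭ (unique∧set⇒bag
    (Uniqueₚ.filter⁺ I? u)
    (Uniqueₚ.filter⁺ I? (HasD.distinct (restrict-HasD d)))
    (mk⇔ to from)))
    where
    I? = inInterval? n
    to : ∀ {a} → a ∈ filter I? S → a ∈ filter I? (restrict S)
    to a∈ with ∈-filter⁻ I? {xs = S} a∈
    ... | a∈S , i = ∈-filter⁺ I? (∈-filter⁺ (_∈? S) (∈-upTo⁺ (proj₂ i)) a∈S) i
    from : ∀ {a} → a ∈ filter I? (restrict S) → a ∈ filter I? S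
    from a∈ with ∈-filter⁻ I? {xs = restrict S} a∈
    ... | a∈T , i = ∈-filter⁺ I? (proj₂ (∈-filter⁻ (_∈? S) {xs = upTo bound} a∈T)) i

  sup-exists : ∃ (IsSup (Counts n))
  sup-exists = max 0 (map (count n) candidates) , mkIsSup
    (λ where
      (S , d , refl) → subst (ℕ._≤ _) (sym (restrict-count d))
        (All.lookup (xs≤max 0 (map (count n) candidates))
          (∈-map⁺ (count n) (∈-filter⁺ (hasD? n)
            (filter∈subsets (_∈? S) (upTo bound)) (restrict-HasD d)))))
    (λ ub → max≤v⁺ z≤n (Allₚ.map⁺ (All.map (λ d → ub (_ , d , refl))
      (Allₚ.all-filter (hasD? n) (subsets (upTo bound))))))
    where
    candidates : List (List ℕ)
    candidates = filter (hasD? n) (subsets (upTo bound))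

B : ℤ → ℕ
B n = proj₁ (sup-exists n)

B-isSup : ∀ n → IsSup (Counts n) (B n)
B-isSup n = proj₂ (sup-exists n)

IsCauchy : (ℕ → ℚ) → Set
IsCauchy x = ∀ ε → 0ℚ ℚ.< ε →
  ∃ λ M → ∀ j k → M ℕ.≤ j → M ℕ.≤ k → ℚ.∣ x j ℚ.- x k ∣ ℚ.< ε

-- Reals are Cauchy sequences of rationals, not quotiented.
record ℝ : Set where
  constructor mkℝ
  field
    seq    : ℕ → ℚ
    cauchy : IsCauchy seq

open ℝ public

infix  4 _<ᵣ_
infixl 6 _+ᵣ_
infixl 7 _·ᵣ_

-- x < y when y - x is eventually bounded below by a positive rational.
_<ᵣ_ : ℝ → ℝ → Set
x <ᵣ y = ∃ λ ε → 0ℚ ℚ.< ε ×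
  ∃ λ M → ∀ k → M ℕ.≤ k → seq x k ℚ.+ ε ℚ.≤ seq y k

fromℚ : ℚ → ℝ
fromℚ q = mkℝ (λ _ → q) λ ε 0<ε → 0 , λ _ _ _ _ →
  subst (ℚ._< ε) (sym (cong ℚ.∣_∣ (ℚₚ.+-inverseʳ q))) 0<ε

fromℕ : ℕ → ℝ
fromℕ m = fromℚ (+ m / 1)

_+ᵣ_ : ℝ → ℝ → ℝ
x +ᵣ y = mkℝ (λ k → seq x k ℚ.+ seq y k) cau
  where
  open +-*-Solver
  rearrange : ∀ a b c d → (a ℚ.+ b) ℚ.- (c ℚ.+ d) ≡ (a ℚ.- c) ℚ.+ (b ℚ.- d)
  rearrange = solve 4 (λ a b c d →
    (a :+ b) :- (c :+ d) := (a :- c) :+ (b :- d)) refl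
  halves : ∀ e → e ℚ.* ℚ.½ ℚ.+ e ℚ.* ℚ.½ ≡ e
  halves = solve 1 (λ e → e :* con ℚ.½ :+ e :* con ℚ.½ := e) refl
  cau : IsCauchy (λ k → seq x k ℚ.+ seq y k)
  cau ε 0<ε = M₁ ℕ.⊔ M₂ , λ j k M≤j M≤k → begin-strict
    ℚ.∣ (seq x j ℚ.+ seq y j) ℚ.- (seq x k ℚ.+ seq y k) ∣
      ≡⟨ cong ℚ.∣_∣ (rearrange (seq x j) (seq y j) (seq x k) (seq y k)) ⟩
    ℚ.∣ (seq x j ℚ.- seq x k) ℚ.+ (seq y j ℚ.- seq y k) ∣
      ≤⟨ ℚₚ.∣p+q∣≤∣p∣+∣q∣ (seq x j ℚ.- seq x k) (seq y j ℚ.- seq y k) ⟩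
    ℚ.∣ seq x j ℚ.- seq x k ∣ ℚ.+ ℚ.∣ seq y j ℚ.- seq y k ∣
      <⟨ ℚₚ.+-mono-<
           (h₁ j k (ℕₚ.m⊔n≤o⇒m≤o M₁ M₂ M≤j) (ℕₚ.m⊔n≤o⇒m≤o M₁ M₂ M≤k))
           (h₂ j k (ℕₚ.m⊔n≤o⇒n≤o M₁ M₂ M≤j) (ℕₚ.m⊔n≤o⇒n≤o M₁ M₂ M≤k)) ⟩
    ε ℚ.* ℚ.½ ℚ.+ ε ℚ.* ℚ.½
      ≡⟨ halves ε ⟩
    ε ∎
    where
    open ℚₚ.≤-Reasoning
    0<ε/2 : 0ℚ ℚ.< ε ℚ.* ℚ.½
    0<ε/2 = subst (ℚ._< ε ℚ.* ℚ.½) (ℚₚ.*-zeroˡ ℚ.½) (ℚₚ.*-monoˡ-<-pos ℚ.½ 0<ε)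
    M₁ = proj₁ (cauchy x (ε ℚ.* ℚ.½) 0<ε/2)
    M₂ = proj₁ (cauchy y (ε ℚ.* ℚ.½) 0<ε/2)
    h₁ = proj₂ (cauchy x (ε ℚ.* ℚ.½) 0<ε/2)
    h₂ = proj₂ (cauchy y (ε ℚ.* ℚ.½) 0<ε/2)

_·ᵣ_ : ℚ → ℝ → ℝ
c ·ᵣ x = mkℝ (λ k → c ℚ.* seq x k) cau
  where
  open +-*-Solver
  factor : ∀ c a b → c ℚ.* a ℚ.- c ℚ.* b ≡ c ℚ.* (a ℚ.- b)
  factor = solve 3 (λ c a b → c :* a :- c :* b := c :* (a :- b)) refl
  C : ℚ
  C = 1ℚ ℚ.+ ℚ.∣ c ∣
  instance
    C-pos : ℚ.Positive C
    C-pos = ℚ.positive (ℚₚ.+-mono-<-≤ (ℚₚ.positive⁻¹ 1ℚ) (ℚₚ.0≤∣p∣ c))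
    C-nonZero : ℚ.NonZero C
    C-nonZero = ℚₚ.pos⇒nonZero C
    1/C-pos : ℚ.Positive (ℚ.1/ C)
    1/C-pos = ℚₚ.1/pos⇒pos C
  cau : IsCauchy (λ k → c ℚ.* seq x k)
  cau ε 0<ε = proj₁ h , λ j k M≤j M≤k → let d = seq x j ℚ.- seq x k in begin-strict
    ℚ.∣ c ℚ.* seq x j ℚ.- c ℚ.* seq x k ∣
      ≡⟨ cong ℚ.∣_∣ (factor c (seq x j) (seq x k)) ⟩
    ℚ.∣ c ℚ.* d ∣
      ≡⟨ ℚₚ.∣p*q∣≡∣p∣*∣q∣ c d ⟩
    ℚ.∣ c ∣ ℚ.* ℚ.∣ d ∣
      ≤⟨ ℚₚ.*-monoʳ-≤-nonNeg ℚ.∣ d ∣ {{ℚₚ.∣-∣-nonNeg d}} ∣c∣≤C ⟩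
    C ℚ.* ℚ.∣ d ∣
      <⟨ ℚₚ.*-monoʳ-<-pos C (proj₂ h j k M≤j M≤k) ⟩
    C ℚ.* (ℚ.1/ C ℚ.* ε)
      ≡⟨ ℚₚ.*-assoc C (ℚ.1/ C) ε ⟨
    C ℚ.* ℚ.1/ C ℚ.* ε
      ≡⟨ cong (ℚ._* ε) (ℚₚ.*-inverseʳ C) ⟩
    1ℚ ℚ.* ε
      ≡⟨ ℚₚ.*-identityˡ ε ⟩
    ε ∎
    where
    open ℚₚ.≤-Reasoning
    ∣c∣≤C : ℚ.∣ c ∣ ℚ.≤ C
    ∣c∣≤C = subst (ℚ._≤ C) (ℚₚ.+-identityˡ ℚ.∣ c ∣)
      (ℚₚ.+-monoˡ-≤ ℚ.∣ c ∣ (ℚₚ.nonNegative⁻¹ 1ℚ))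
    0<ε/C : 0ℚ ℚ.< ℚ.1/ C ℚ.* ε
    0<ε/C = subst (ℚ._< ℚ.1/ C ℚ.* ε) (ℚₚ.*-zeroʳ (ℚ.1/ C))
      (ℚₚ.*-monoʳ-<-pos (ℚ.1/ C) 0<ε)
    h = cauchy x (ℚ.1/ C ℚ.* ε) 0<ε/C

∑ : ℕ → (ℕ → ℚ) → ℚ
∑ zero    f = 0ℚ
∑ (suc m) f = ∑ m f ℚ.+ f m

recip : ℕ → ℚ
recip a = + 1 / suc a

-- The natural logarithm is log N = ∫₁ᴺ dt/t; this is its right Riemann sum for
-- the partition of [1, N] into intervals of length 1/m, m = suc k, with terms
-- 1/m · 1/(1 + (i+1)/m) = 1/(m + i + 1) for i < (N - 1) m.
logSum : ℕ → ℕ → ℚ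
logSum N k = ∑ ((N ℕ.∸ 1) ℕ.* suc k) (λ i → recip (suc k ℕ.+ i))

∑-mono : ∀ m {f g} → (∀ i → i ℕ.< m → f i ℚ.≤ g i) → ∑ m f ℚ.≤ ∑ m g
∑-mono zero    h = ℚₚ.≤-refl
∑-mono (suc m) h = ℚₚ.+-mono-≤ (∑-mono m (λ i i<m → h i (ℕₚ.m<n⇒m<1+n i<m))) (h m ℕₚ.≤-refl)

∑-cong : ∀ m {f g} → (∀ i → f i ≡ g i) → ∑ m f ≡ ∑ m g
∑-cong zero    h = refl
∑-cong (suc m) h = cong₂ ℚ._+_ (∑-cong m h) (h m)

∑-split : ∀ m k f → ∑ (m ℕ.+ k) f ≡ ∑ m f ℚ.+ ∑ k (λ i → f (m ℕ.+ i))
∑-split m zero    f rewrite ℕₚ.+-identityʳ m = sym (ℚₚ.+-identityʳ _)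
∑-split m (suc k) f rewrite ℕₚ.+-suc m k =
  trans (cong (ℚ._+ f (m ℕ.+ k)) (∑-split m k f)) (ℚₚ.+-assoc (∑ m f) _ _)

∑-blocks : ∀ k m f → ∑ (k ℕ.* m) f ≡ ∑ m (λ i → ∑ k (λ l → f (k ℕ.* i ℕ.+ l)))
∑-blocks k zero    f rewrite ℕₚ.*-zeroʳ k = refl
∑-blocks k (suc m) f = begin
  ∑ (k ℕ.* suc m) f
    ≡⟨ cong (λ z → ∑ z f) (trans (ℕₚ.*-suc k m) (ℕₚ.+-comm k (k ℕ.* m))) ⟩
  ∑ (k ℕ.* m ℕ.+ k) f
    ≡⟨ ∑-split (k ℕ.* m) k f ⟩
  ∑ (k ℕ.* m) f ℚ.+ ∑ k (λ l → f (k ℕ.* m ℕ.+ l))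
    ≡⟨ cong (ℚ._+ ∑ k (λ l → f (k ℕ.* m ℕ.+ l))) (∑-blocks k m f) ⟩
  ∑ (suc m) (λ i → ∑ k (λ l → f (k ℕ.* i ℕ.+ l))) ∎
  where open ≡-Reasoning

∑-const : ∀ m c → ∑ m (λ _ → c) ≡ (+ m / 1) ℚ.* c
∑-const zero    c = sym (ℚₚ.*-zeroˡ c)
∑-const (suc m) c = begin
  ∑ m (λ _ → c) ℚ.+ c                    ≡⟨ cong (ℚ._+ c) (∑-const m c) ⟩
  (+ m / 1) ℚ.* c ℚ.+ c                  ≡⟨ cong ((+ m / 1) ℚ.* c ℚ.+_) (ℚₚ.*-identityˡ c) ⟨
  (+ m / 1) ℚ.* c ℚ.+ 1ℚ ℚ.* c           ≡⟨ ℚₚ.*-distribʳ-+ c (+ m / 1) 1ℚ ⟨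
  ((+ m / 1) ℚ.+ 1ℚ) ℚ.* c               ≡⟨ cong (ℚ._* c) step ⟩
  (+ suc m / 1) ℚ.* c                    ∎
  where
  open ≡-Reasoning
  step : (+ m / 1) ℚ.+ 1ℚ ≡ + suc m / 1
  step = ℚₚ.toℚᵘ-injective (ℚᵘₚ.≃-trans (ℚₚ.toℚᵘ-homo-+ (+ m / 1) 1ℚ)
    (ℚᵘₚ.≃-trans (ℚᵘₚ.+-congˡ ℚᵘ.1ℚᵘ (ℚₚ.toℚᵘ-fromℚᵘ (ℚᵘ.mkℚᵘ (+ m) 0)))
    (ℚᵘₚ.≃-trans (ℚᵘ.*≡* (arith (+ m)))
      (ℚᵘₚ.≃-sym (ℚₚ.toℚᵘ-fromℚᵘ (ℚᵘ.mkℚᵘ (+ suc m) 0))))))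
    where
    open ℤ-Solver.+-*-Solver
    arith : ∀ z → (z ℤ.* + 1 ℤ.+ + 1 ℤ.* + 1) ℤ.* + 1 ≡ (+ 1 ℤ.+ z) ℤ.* (+ 1 ℤ.* + 1)
    arith = solve 1 (λ z → (z :* con (+ 1) :+ con (+ 1) :* con (+ 1)) :* con (+ 1)
      := (con (+ 1) :+ z) :* (con (+ 1) :* con (+ 1))) refl

recip-ᵘ : ∀ a → ℚ.toℚᵘ (recip a) ℚᵘ.≃ ℚᵘ.mkℚᵘ (+ 1) a
recip-ᵘ a = ℚₚ.toℚᵘ-fromℚᵘ (ℚᵘ.mkℚᵘ (+ 1) a)

recip-anti : ∀ {a b} → a ℕ.≤ b → recip b ℚ.≤ recip a
recip-anti {a} {b} a≤b = ℚₚ.toℚᵘ-cancel-≤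
  (ℚᵘₚ.≤-respˡ-≃ (ℚᵘₚ.≃-sym (recip-ᵘ b)) (ℚᵘₚ.≤-respʳ-≃ (ℚᵘₚ.≃-sym (recip-ᵘ a))
    (ℚᵘ.*≤* (ℤₚ.*-monoˡ-≤-nonNeg (+ 1) (ℤ.+≤+ (s≤s a≤b))))))

recip-nonNeg : ∀ a → 0ℚ ℚ.≤ recip a
recip-nonNeg a = ℚₚ.toℚᵘ-cancel-≤ (ℚᵘₚ.≤-respʳ-≃ (ℚᵘₚ.≃-sym (recip-ᵘ a))
  (ℚᵘ.*≤* (ℤ.+≤+ z≤n)))

recip-scale : ∀ k a → recip a ≡ (+ suc k / 1) ℚ.* recip (k ℕ.+ suc k ℕ.* a)
recip-scale k a = ℚₚ.toℚᵘ-injective (ℚᵘₚ.≃-trans (recip-ᵘ a) (ℚᵘₚ.≃-sym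
  (ℚᵘₚ.≃-trans (ℚₚ.toℚᵘ-homo-* (+ suc k / 1) (recip b))
  (ℚᵘₚ.≃-trans (ℚᵘₚ.*-cong (ℚₚ.toℚᵘ-fromℚᵘ (ℚᵘ.mkℚᵘ (+ suc k) 0)) (recip-ᵘ b))
    (ℚᵘ.*≡* (begin
      (+ suc k ℤ.* + 1) ℤ.* + suc a    ≡⟨ cong (ℤ._* + suc a) (ℤₚ.*-identityʳ (+ suc k)) ⟩
      + suc k ℤ.* + suc a              ≡⟨ ℤₚ.pos-* (suc k) (suc a) ⟨
      + (suc k ℕ.* suc a)              ≡⟨ cong +_ (ℕₚ.*-suc (suc k) a) ⟩
      + suc b                          ≡⟨ cong +_ (ℕₚ.+-identityʳ (suc b)) ⟨
      + (1 ℕ.* suc b)                  ≡⟨ ℤₚ.pos-* 1 (suc b) ⟩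
      + 1 ℤ.* + suc b                  ≡⟨ cong (λ z → + 1 ℤ.* + suc z) (ℕₚ.+-identityʳ b) ⟨
      + 1 ℤ.* + suc (b ℕ.+ 0)          ∎))))))
  where
  open ≡-Reasoning
  b = k ℕ.+ suc k ℕ.* a

-- Refining the partition does not decrease a right Riemann sum …
refine-lower : ∀ k m a → ∑ m (λ i → recip (a ℕ.+ i))
  ℚ.≤ ∑ (suc k ℕ.* m) (λ i → recip (suc k ℕ.* a ℕ.+ i))
refine-lower k m a = begin
  ∑ m (λ i → recip (a ℕ.+ i))
    ≤⟨ ∑-mono m (λ i _ → block i) ⟩
  ∑ m (λ i → ∑ (suc k) (λ l → recip (suc k ℕ.* a ℕ.+ (suc k ℕ.* i ℕ.+ l))))
    ≡⟨ ∑-blocks (suc k) m _ ⟨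
  ∑ (suc k ℕ.* m) (λ i → recip (suc k ℕ.* a ℕ.+ i)) ∎
  where
  open ℚₚ.≤-Reasoning
  le : ∀ i l → l ℕ.< suc k →
       suc k ℕ.* a ℕ.+ (suc k ℕ.* i ℕ.+ l) ℕ.≤ k ℕ.+ suc k ℕ.* (a ℕ.+ i)
  le i l (s≤s l≤k) = subst₂ ℕ._≤_
    (ℕₚ.+-assoc (suc k ℕ.* a) (suc k ℕ.* i) l)
    (trans (ℕₚ.+-comm _ k) (cong (k ℕ.+_) (sym (ℕₚ.*-distribˡ-+ (suc k) a i))))
    (ℕₚ.+-monoʳ-≤ (suc k ℕ.* a ℕ.+ suc k ℕ.* i) l≤k)
  block : ∀ i → recip (a ℕ.+ i)
    ℚ.≤ ∑ (suc k) (λ l → recip (suc k ℕ.* a ℕ.+ (suc k ℕ.* i ℕ.+ l)))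
  block i = begin
    recip (a ℕ.+ i)
      ≡⟨ recip-scale k (a ℕ.+ i) ⟩
    (+ suc k / 1) ℚ.* recip (k ℕ.+ suc k ℕ.* (a ℕ.+ i))
      ≡⟨ ∑-const (suc k) _ ⟨
    ∑ (suc k) (λ _ → recip (k ℕ.+ suc k ℕ.* (a ℕ.+ i)))
      ≤⟨ ∑-mono (suc k) (λ l l<k → recip-anti (le i l l<k)) ⟩
    ∑ (suc k) (λ l → recip (suc k ℕ.* a ℕ.+ (suc k ℕ.* i ℕ.+ l))) ∎

-- … and does not increase a left one.
refine-upper : ∀ k m b → ∑ (suc k ℕ.* m) (λ i → recip (suc k ℕ.* suc b ℕ.+ i))
  ℚ.≤ ∑ m (λ i → recip (b ℕ.+ i))
refine-upper k m b = begin
  ∑ (suc k ℕ.* m) (λ i → recip (suc k ℕ.* suc b ℕ.+ i))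
    ≡⟨ ∑-blocks (suc k) m _ ⟩
  ∑ m (λ i → ∑ (suc k) (λ l → recip (suc k ℕ.* suc b ℕ.+ (suc k ℕ.* i ℕ.+ l))))
    ≤⟨ ∑-mono m (λ i _ → block i) ⟩
  ∑ m (λ i → recip (b ℕ.+ i)) ∎
  where
  open ℚₚ.≤-Reasoning
  le : ∀ i l → k ℕ.+ suc k ℕ.* (b ℕ.+ i)
       ℕ.≤ suc k ℕ.* suc b ℕ.+ (suc k ℕ.* i ℕ.+ l)
  le i l = ℕₚ.≤-trans (ℕₚ.n≤1+n _) (subst₂ ℕ._≤_
    (ℕₚ.*-suc (suc k) (b ℕ.+ i))
    (trans (cong (ℕ._+ l) (ℕₚ.*-distribˡ-+ (suc k) (suc b) i))
      (ℕₚ.+-assoc (suc k ℕ.* suc b) (suc k ℕ.* i) l))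
    (ℕₚ.m≤m+n (suc k ℕ.* suc (b ℕ.+ i)) l))
  block : ∀ i → ∑ (suc k) (λ l → recip (suc k ℕ.* suc b ℕ.+ (suc k ℕ.* i ℕ.+ l)))
    ℚ.≤ recip (b ℕ.+ i)
  block i = begin
    ∑ (suc k) (λ l → recip (suc k ℕ.* suc b ℕ.+ (suc k ℕ.* i ℕ.+ l)))
      ≤⟨ ∑-mono (suc k) (λ l _ → recip-anti (le i l)) ⟩
    ∑ (suc k) (λ _ → recip (k ℕ.+ suc k ℕ.* (b ℕ.+ i)))
      ≡⟨ ∑-const (suc k) _ ⟩
    (+ suc k / 1) ℚ.* recip (k ℕ.+ suc k ℕ.* (b ℕ.+ i))
      ≡⟨ recip-scale k (b ℕ.+ i) ⟨
    recip (b ℕ.+ i) ∎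

left≤right : ∀ m b → ∑ m (λ i → recip (b ℕ.+ i))
  ℚ.≤ ∑ m (λ i → recip (suc b ℕ.+ i)) ℚ.+ recip b
left≤right m b = begin
  ∑ m (λ i → recip (b ℕ.+ i))
    ≤⟨ subst (ℚ._≤ ∑ (suc m) f) (ℚₚ.+-identityʳ (∑ m f))
         (ℚₚ.+-monoʳ-≤ (∑ m f) (recip-nonNeg (b ℕ.+ m))) ⟩
  ∑ (suc m) (λ i → recip (b ℕ.+ i))
    ≡⟨ telescope m ⟩
  ∑ m (λ i → recip (suc b ℕ.+ i)) ℚ.+ recip b ∎
  where
  open ℚₚ.≤-Reasoning
  f : ℕ → ℚ
  f i = recip (b ℕ.+ i)
  telescope : ∀ m → ∑ (suc m) (λ i → recip (b ℕ.+ i))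
    ≡ ∑ m (λ i → recip (suc b ℕ.+ i)) ℚ.+ recip b
  telescope m = trans (∑-split 1 m (λ i → recip (b ℕ.+ i)))
    (trans (ℚₚ.+-comm _ (∑ m _))
      (cong₂ ℚ._+_ (∑-cong m (λ i → cong recip (ℕₚ.+-suc b i)))
        (trans (ℚₚ.+-identityˡ _) (cong recip (ℕₚ.+-identityʳ b)))))

logSum-close : ∀ N j k → logSum N j ℚ.≤ logSum N k ℚ.+ recip k
logSum-close N j k = begin
  logSum N j
    ≤⟨ refine-lower k (M ℕ.* suc j) (suc j) ⟩
  ∑ (suc k ℕ.* (M ℕ.* suc j)) (λ i → recip (suc k ℕ.* suc j ℕ.+ i))
    ≡⟨ cong (λ z → ∑ z (λ i → recip (suc k ℕ.* suc j ℕ.+ i))) size ⟩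
  ∑ (suc j ℕ.* (M ℕ.* suc k)) (λ i → recip (suc k ℕ.* suc j ℕ.+ i))
    ≡⟨ ∑-cong (suc j ℕ.* (M ℕ.* suc k))
         (λ i → cong (λ z → recip (z ℕ.+ i)) (ℕₚ.*-comm (suc k) (suc j))) ⟩
  ∑ (suc j ℕ.* (M ℕ.* suc k)) (λ i → recip (suc j ℕ.* suc k ℕ.+ i))
    ≤⟨ refine-upper j (M ℕ.* suc k) k ⟩
  ∑ (M ℕ.* suc k) (λ i → recip (k ℕ.+ i))
    ≤⟨ left≤right (M ℕ.* suc k) k ⟩
  logSum N k ℚ.+ recip k ∎
  where
  open ℚₚ.≤-Reasoning
  M = N ℕ.∸ 1
  size : suc k ℕ.* (M ℕ.* suc j) ≡ suc j ℕ.* (M ℕ.* suc k)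
  size = trans (ℕₚ.*-comm (suc k) (M ℕ.* suc j))
    (trans (cong (ℕ._* suc k) (ℕₚ.*-comm M (suc j))) (ℕₚ.*-assoc (suc j) M (suc k)))

recip-archimedean : ∀ ε → 0ℚ ℚ.< ε → ∃ λ M → recip M ℚ.< ε
recip-archimedean (mkℚ -[1+ _ ] _ _) (ℚ.*<* ())
recip-archimedean (mkℚ (+ zero) _ _) (ℚ.*<* (ℤ.+<+ ()))
recip-archimedean (mkℚ (+ suc p) d _) _ = suc d , ℚₚ.toℚᵘ-cancel-<
  (ℚᵘₚ.<-respˡ-≃ (ℚᵘₚ.≃-sym (recip-ᵘ (suc d))) (ℚᵘ.*<* (subst₂ ℤ._<_
    (ℤₚ.pos-* 1 (suc d)) (ℤₚ.pos-* (suc p) (suc (suc d)))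
    (ℤ.+<+ (ℕₚ.<-≤-trans
      (subst (ℕ._< suc (suc d)) (sym (ℕₚ.*-identityˡ (suc d))) ℕₚ.≤-refl)
      (ℕₚ.m≤n*m (suc (suc d)) (suc p)))))))

∣-∣-bound : ∀ {a b c} → a ℚ.≤ b ℚ.+ c → b ℚ.≤ a ℚ.+ c → ℚ.∣ a ℚ.- b ∣ ℚ.≤ c
∣-∣-bound {a} {b} {c} h₁ h₂ with ℚₚ.∣p∣≡p∨∣p∣≡-p (a ℚ.- b)
... | inj₁ eq = subst₂ ℚ._≤_ (sym eq) (cancel b c) (ℚₚ.+-monoˡ-≤ (ℚ.- b) h₁)
  where
  open +-*-Solver
  cancel : ∀ b c → (b ℚ.+ c) ℚ.- b ≡ c
  cancel = solve 2 (λ b c → (b :+ c) :- b := c) refl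
... | inj₂ eq = subst₂ ℚ._≤_ (trans (flip a b) (sym eq)) (cancel a c)
  (ℚₚ.+-monoˡ-≤ (ℚ.- a) h₂)
  where
  open +-*-Solver
  cancel : ∀ b c → (b ℚ.+ c) ℚ.- b ≡ c
  cancel = solve 2 (λ b c → (b :+ c) :- b := c) refl
  flip : ∀ a b → b ℚ.- a ≡ ℚ.- (a ℚ.- b)
  flip = solve 2 (λ a b → b :- a := :- (a :- b)) refl

logSum-cauchy : ∀ N → IsCauchy (logSum N)
logSum-cauchy N ε 0<ε with recip-archimedean ε 0<ε
... | M , r<ε = M , λ j k M≤j M≤k → ℚₚ.≤-<-trans
  (∣-∣-bound
    (ℚₚ.≤-trans (logSum-close N j k) (ℚₚ.+-monoʳ-≤ (logSum N k) (recip-anti M≤k)))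
    (ℚₚ.≤-trans (logSum-close N k j) (ℚₚ.+-monoʳ-≤ (logSum N j) (recip-anti M≤j))))
  r<ε

log : (N : ℕ) .{{_ : ℕ.NonZero N}} → ℝ
log N = mkℝ (logSum N) (logSum-cauchy N)

{-# OPTIONS --safe #-}

-- For a D(n)-triple a < b < c with ab + n = r², ac + n = s², bc + n = t² the integers
-- e = n(a + b + c) + 2abc - 2rst, x = at - rs, y = bs - rt satisfy ae + n² = x²,
-- be + n² = y² and c = a + b + e/n + (2/n²)(abe + rxy), with xy ≥ 0. If a > n², then
-- e ≥ 0; e = 0 means c = a + b + 2r, and e ≥ 1 forces c ≥ (17/3)b. Hence c ≥ 4a for every
-- triple in (n², |n|³), and d ≥ (17/3)c for every quadruple a < b < c < d, since d cannot
-- be equal to both a + c + 2s and b + c + 2t. As (17/3)² > 32, m elements in the interval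
-- give |n| ≥ 4 · 32ⁱ if m = 3 + 2i and |n| ≥ 21 · 32ⁱ if m = 4 + 2i, and the bounds follow
-- from log 4 > 1.38, log 21 > 3.02, log 32 > 3.4.

module Submission where

open import Defs
open import Data.Nat using (_<_)
open import Data.Integer using (ℤ; +_; ∣_∣; NonZero)
open import Data.Rational using (_/_)
open import Data.Product using (_×_)

open import Data.Integer as ℤ hiding (suc; _<_; _/_)
open import Data.Integer.Properties
open import Data.Integer.Tactic.RingSolver using (solve-∀)
open import Data.Nat as ℕ using (ℕ; suc; zero; z≤n)
import Data.Nat.DivMod as ℕ
import Data.Nat.Properties as ℕₚ
open import Data.Nat.Tactic.RingSolver using () renaming (solve-∀ to ℕ-solve-∀)
open import Data.Rational as ℚ using (ℚ; 0ℚ; 1ℚ)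
import Data.Rational.Properties as ℚₚ
open import Data.Rational.Solver using (module +-*-Solver)
open import Data.List using (_∷_; []; length)
open import Data.List.Relation.Binary.Permutation.Propositional using (_↭_; ↭-sym; ↭⇒↭ₛ)
open import Data.List.Relation.Binary.Permutation.Propositional.Properties
  using (All-resp-↭; ↭-length)
import Data.List.Relation.Binary.Permutation.Setoid.Properties as ↭ₛ
open import Data.List.Relation.Unary.All as All using (All; []; _∷_)
import Data.List.Relation.Unary.All.Properties as Allₚ
open import Data.List.Relation.Unary.AllPairs as AllPairs using (AllPairs; []; _∷_)
import Data.List.Relation.Unary.AllPairs.Properties as AllPairsₚ
import Data.List.Relation.Unary.Sorted.TotalOrder.Properties as Sortedₚ
import Data.List.Sort as Sort
open import Data.Product using (∃; _,_; proj₁; proj₂)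
open import Data.Sum using (_⊎_; inj₁; inj₂)
open import Relation.Binary.Bundles using (DecTotalOrder)
import Relation.Binary.Construct.Flip.EqAndOrd as Flip
open import Relation.Binary.PropositionalEquality
open import Relation.Nullary using (yes; no; contradiction)
open import Relation.Nullary.Decidable using (True; toWitness)

-- Integer inequalities and nonnegative square roots.

-- Inequalities are kept in the form 0 ≤ p, and strict ones in the form 0 ≤ p - 1,
-- so that an inequality follows from a ring identity between nonnegative terms.
infixl 6 _⊕_
infixl 7 _⊗_

_⊕_ : ∀ {p q} → 0ℤ ≤ p → 0ℤ ≤ q → 0ℤ ≤ p + q
_⊕_ = +-mono-≤

_⊗_ : ∀ {p q} → 0ℤ ≤ p → 0ℤ ≤ q → 0ℤ ≤ p * q
_⊗_ {+ p} {+ q} _ _ = subst (0ℤ ≤_) (pos-* p q) (+≤+ z≤n)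

0≤+ : ∀ k → 0ℤ ≤ + k
0≤+ k = +≤+ z≤n

by : ∀ {p q} → p ≡ q → 0ℤ ≤ q → 0ℤ ≤ p
by refl h = h

<⇒0≤ : ∀ {p q} → p ℤ.< q → 0ℤ ≤ q - p - 1ℤ
<⇒0≤ {p} {q} p<q = by (lemma p q) (i≤j⇒0≤j-i (i<j⇒suc[i]≤j p<q))
  where
  lemma : ∀ p q → q - p - 1ℤ ≡ q - (1ℤ + p)
  lemma = solve-∀

1≤-* : ∀ p q → 0ℤ ≤ p - 1ℤ → 0ℤ ≤ q - 1ℤ → 0ℤ ≤ p * q - 1ℤ
1≤-* p q hp hq = by (lemma p q) (hp ⊗ hq ⊕ hp ⊕ hq)
  where
  lemma : ∀ p q → p * q - 1ℤ ≡ (p - 1ℤ) * (q - 1ℤ) + (p - 1ℤ) + (q - 1ℤ)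
  lemma = solve-∀

absurd : ∀ {p} {A : Set} → 0ℤ ≤ p → 0ℤ ≤ - p - 1ℤ → A
absurd {p} h h′ with by (lemma p) (h ⊕ h′)
  where
  lemma : ∀ p → -1ℤ ≡ p + (- p - 1ℤ)
  lemma = solve-∀
... | ()

-- No sign of `q` is assumed: if `q` exceeds `p`, then `q - p` and `q + p` are both at least 1, and
-- so is their product.
square-cancel-≤ : ∀ {p q} → 0ℤ ≤ p → 0ℤ ≤ p * p - q * q → 0ℤ ≤ p - q
square-cancel-≤ {p} {q} hp h with q ≤? p
... | yes q≤p = i≤j⇒0≤j-i q≤p
... | no  q≰p = absurd h (by (lemma₁ p q) (1≤-* (q - p) (q + p) d (by (lemma₂ p q) (d ⊕ hp ⊕ hp))))
  where
  d = <⇒0≤ (≰⇒> q≰p)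
  lemma₁ : ∀ p q → - (p * p - q * q) - 1ℤ ≡ (q - p) * (q + p) - 1ℤ
  lemma₁ = solve-∀
  lemma₂ : ∀ p q → (q + p) - 1ℤ ≡ (q - p - 1ℤ) + p + p
  lemma₂ = solve-∀

*-cancelˡ-0≤ : ∀ p {q} → 0ℤ ≤ p - 1ℤ → 0ℤ ≤ p * q → 0ℤ ≤ q
*-cancelˡ-0≤ p {q} hp h with 0ℤ ≤? q
... | yes 0≤q = 0≤q
... | no  0≰q = absurd h (by (lemma₁ p q) (1≤-* p (- q) hp (by (lemma₂ q) (<⇒0≤ (≰⇒> 0≰q)))))
  where
  lemma₁ : ∀ p q → - (p * q) - 1ℤ ≡ p * (- q) - 1ℤ
  lemma₁ = solve-∀
  lemma₂ : ∀ q → (- q) - 1ℤ ≡ 0ℤ - q - 1ℤ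
  lemma₂ = solve-∀

-- Together with `a > n²` this makes `a + n` positive, so the estimates for triples need no case
-- split on the sign of `n`.
0≤n²+n : ∀ n → 0ℤ ≤ n * n + n
0≤n²+n n@(+ _)   = nn ⊗ nn ⊕ nn where nn = nonNegative⁻¹ n
0≤n²+n -[1+ m ]  = by (lemma (+ m)) (h ⊗ h ⊕ h)
  where
  h = nonNegative⁻¹ (+ m)
  lemma : ∀ x → (- (1ℤ + x)) * (- (1ℤ + x)) + (- (1ℤ + x)) ≡ x * x + x
  lemma = solve-∀

1≤n² : ∀ n .{{_ : NonZero n}} → 0ℤ ≤ n * n - 1ℤ
1≤n² (+ suc m) = by (lemma (+ m)) (h ⊗ h ⊕ h ⊕ h)
  where
  h = nonNegative⁻¹ (+ m)
  lemma : ∀ x → (1ℤ + x) * (1ℤ + x) - 1ℤ ≡ x * x + x + x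
  lemma = solve-∀
1≤n² -[1+ m ]  = by (lemma (+ m)) (h ⊗ h ⊕ h ⊕ h)
  where
  h = nonNegative⁻¹ (+ m)
  lemma : ∀ x → (- (1ℤ + x)) * (- (1ℤ + x)) - 1ℤ ≡ x * x + x + x
  lemma = solve-∀

0≤square : ∀ x → 0ℤ ≤ x * x
0≤square (+ m)    = nonNegative⁻¹ (+ m) ⊗ nonNegative⁻¹ (+ m)
0≤square -[1+ m ] = +≤+ z≤n

record IsRoot (z r : ℤ) : Set where
  constructor mkIsRoot
  field
    nonneg : 0ℤ ≤ r
    root   : r * r ≡ z

nonNegRoot : ∀ {z} → IsSquare z → ∃ (IsRoot z)
nonNegRoot (+ m , refl)      = + m , mkIsRoot (+≤+ z≤n) refl
nonNegRoot (-[1+ m ] , refl) = + suc m , mkIsRoot (+≤+ z≤n) refl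

-- D(n)-triples above n²: regular or far apart.

module Triple {n : ℤ} .{{_ : NonZero n}} {a b c r s t : ℤ}
  (n²<a : n * n ℤ.< a) (a<b : a ℤ.< b) (b<c : b ℤ.< c)
  (hr : IsRoot (a * b + n) r) (hs : IsRoot (a * c + n) s) (ht : IsRoot (b * c + n) t)
  where

  private
    r² = IsRoot.root hr
    s² = IsRoot.root hs
    t² = IsRoot.root ht
    0≤r = IsRoot.nonneg hr
    0≤s = IsRoot.nonneg hs
    0≤t = IsRoot.nonneg ht

    e x y : ℤ
    e = n * (a + b + c) + + 2 * a * b * c - + 2 * (r * s * t)
    x = a * t - r * s
    y = b * s - r * t

    0≤n² : 0ℤ ≤ n * n
    0≤n² = 0≤square n
    α = <⇒0≤ n²<a
    β = <⇒0≤ a<b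
    γ = <⇒0≤ b<c
    ν = 0≤n²+n n

    0≤a : 0ℤ ≤ a
    0≤a = ≤-trans 0≤n² (<⇒≤ n²<a)
    0≤b : 0ℤ ≤ b
    0≤b = ≤-trans 0≤a (<⇒≤ a<b)
    0≤c : 0ℤ ≤ c
    0≤c = ≤-trans 0≤b (<⇒≤ b<c)

    -- The square roots are eliminated in two stages: expansion isolates `r * r`, `s * s`, `t * t`
    -- and the monomial `r * s * t`; after substitution a polynomial identity remains in which that
    -- monomial is a free variable `w`. The same pattern gives `y²` and `n²c`.
    x² : x * x ≡ a * e + n * n
    x² = begin
      x * x
        ≡⟨ lemma₁ a r s t ⟩
      a * a * (t * t) + r * r * (s * s) - + 2 * a * (r * s * t)
        ≡⟨ cong₂ (λ p q → a * a * p + q - + 2 * a * (r * s * t)) t² (cong₂ _*_ r² s²) ⟩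
      a * a * (b * c + n) + (a * b + n) * (a * c + n) - + 2 * a * (r * s * t)
        ≡⟨ lemma₂ n a b c (r * s * t) ⟩
      a * e + n * n ∎
      where
      open ≡-Reasoning
      lemma₁ : ∀ a r s t → (a * t - r * s) * (a * t - r * s)
        ≡ a * a * (t * t) + r * r * (s * s) - + 2 * a * (r * s * t)
      lemma₁ = solve-∀
      lemma₂ : ∀ n a b c w →
        a * a * (b * c + n) + (a * b + n) * (a * c + n) - + 2 * a * w
        ≡ a * (n * (a + b + c) + + 2 * a * b * c - + 2 * w) + n * n
      lemma₂ = solve-∀

    y² : y * y ≡ b * e + n * n
    y² = begin
      y * y
        ≡⟨ lemma₁ b r s t ⟩
      b * b * (s * s) + r * r * (t * t) - + 2 * b * (r * s * t)
        ≡⟨ cong₂ (λ p q → b * b * p + q - + 2 * b * (r * s * t)) s² (cong₂ _*_ r² t²) ⟩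
      b * b * (a * c + n) + (a * b + n) * (b * c + n) - + 2 * b * (r * s * t)
        ≡⟨ lemma₂ n a b c (r * s * t) ⟩
      b * e + n * n ∎
      where
      open ≡-Reasoning
      lemma₁ : ∀ b r s t → (b * s - r * t) * (b * s - r * t)
        ≡ b * b * (s * s) + r * r * (t * t) - + 2 * b * (r * s * t)
      lemma₁ = solve-∀
      lemma₂ : ∀ n a b c w →
        b * b * (a * c + n) + (a * b + n) * (b * c + n) - + 2 * b * w
        ≡ b * (n * (a + b + c) + + 2 * a * b * c - + 2 * w) + n * n
      lemma₂ = solve-∀

    -- The formula c = a + b + e/n + (2/n²)(abe + rxy), multiplied by n².
    n²c : n * n * c ≡ n * n * (a + b) + (n + + 2 * a * b) * e + + 2 * (r * (x * y))
    n²c = sym (begin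
      n * n * (a + b) + (n + + 2 * a * b) * e + + 2 * (r * (x * y))
        ≡⟨ lemma₁ (n * n * (a + b) + (n + + 2 * a * b) * e) a b r s t ⟩
      n * n * (a + b) + (n + + 2 * a * b) * e
        + + 2 * ((a * b + r * r) * (r * s * t) - a * (r * r) * (t * t) - b * (r * r) * (s * s))
        ≡⟨ cong (λ p → n * n * (a + b) + (n + + 2 * a * b) * e
            + + 2 * ((a * b + p) * (r * s * t) - a * p * (t * t) - b * p * (s * s))) r² ⟩
      n * n * (a + b) + (n + + 2 * a * b) * e
        + + 2 * ((a * b + R) * (r * s * t) - a * R * (t * t) - b * R * (s * s))
        ≡⟨ cong₂ (λ p q → n * n * (a + b) + (n + + 2 * a * b) * e
            + + 2 * ((a * b + R) * (r * s * t) - a * R * p - b * R * q)) t² s² ⟩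
      n * n * (a + b) + (n + + 2 * a * b) * e
        + + 2 * ((a * b + R) * (r * s * t) - a * R * (b * c + n) - b * R * (a * c + n))
        ≡⟨ lemma₂ n a b c (r * s * t) ⟩
      n * n * c ∎)
      where
      open ≡-Reasoning
      R = a * b + n
      lemma₁ : ∀ z a b r s t → z + + 2 * (r * ((a * t - r * s) * (b * s - r * t)))
        ≡ z + + 2 * ((a * b + r * r) * (r * s * t) - a * (r * r) * (t * t) - b * (r * r) * (s * s))
      lemma₁ = solve-∀
      lemma₂ : ∀ n a b c w →
        n * n * (a + b) + (n + + 2 * a * b) * (n * (a + b + c) + + 2 * a * b * c - + 2 * w)
        + + 2 * ((a * b + (a * b + n)) * w - a * (a * b + n) * (b * c + n)
                 - b * (a * b + n) * (a * c + n))
        ≡ n * n * c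
      lemma₂ = solve-∀

    -- x and y have the same sign, opposite to that of n:
    -- a²t² - r²s² = -nP and b²s² - r²t² = -nQ with P, Q > 0.
    0≤xy : 0ℤ ≤ x * y
    0≤xy with 0ℤ ≤? x * y
    ... | yes h = h
    ... | no  h = absurd (by product (by (neg-< (x * y)) (<⇒0≤ (≰⇒> h) ⊕ 0≤+ 1) ⊗ 0≤W))
                    (by (dneg (n * n * (P * Q))) (1≤-* (n * n) (P * Q) (1≤n² n) (1≤-* P Q 1≤P 1≤Q)))
      where
      -- By `product`, `x * y * W` equals n²PQ ≥ 1; since `W` is nonnegative, `x * y` cannot be
      -- negative.
      W = (a * t + r * s) * (b * s + r * t)
      0≤W : 0ℤ ≤ W
      0≤W = (0≤a ⊗ 0≤t ⊕ 0≤r ⊗ 0≤s) ⊗ (0≤b ⊗ 0≤s ⊕ 0≤r ⊗ 0≤t)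
      neg-< : ∀ p → - p ≡ 0ℤ - p - 1ℤ + 1ℤ
      neg-< = solve-∀
      dneg : ∀ p → - (- p) - 1ℤ ≡ p - 1ℤ
      dneg = solve-∀
      P Q : ℤ
      P = a * (b + c - a) + n
      Q = b * (a + c - b) + n
      1≤P : 0ℤ ≤ P - 1ℤ
      1≤P = by (lemma n a b c) (α ⊕ ν ⊕ 0≤a ⊗ (β ⊕ 0≤c))
        where
        lemma : ∀ n a b c → (a * (b + c - a) + n) - 1ℤ
          ≡ (a - n * n - 1ℤ) + (n * n + n) + a * ((b - a - 1ℤ) + c)
        lemma = solve-∀
      1≤Q : 0ℤ ≤ Q - 1ℤ
      1≤Q = by (lemma n a b c) (α ⊕ ν ⊕ 0≤b ⊗ γ ⊕ 0≤a ⊗ (β ⊕ 0≤a) ⊕ 0≤b)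
        where
        lemma : ∀ n a b c → (b * (a + c - b) + n) - 1ℤ
          ≡ (a - n * n - 1ℤ) + (n * n + n) + b * (c - b - 1ℤ) + a * ((b - a - 1ℤ) + a) + b
        lemma = solve-∀
      product : - (n * n * ((a * (b + c - a) + n) * (b * (a + c - b) + n))) ≡ - (x * y) * W
      product = sym (begin
        - (x * y) * W
          ≡⟨ lemma₁ a b r s t ⟩
        - ((a * a * (t * t) - r * r * (s * s)) * (b * b * (s * s) - r * r * (t * t)))
          ≡⟨ cong (λ p → - ((a * a * (t * t) - p * (s * s)) * (b * b * (s * s) - p * (t * t)))) r² ⟩
        - ((a * a * (t * t) - R * (s * s)) * (b * b * (s * s) - R * (t * t)))
          ≡⟨ cong₂ (λ p q → - ((a * a * q - R * p) * (b * b * p - R * q))) s² t² ⟩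
        - ((a * a * (b * c + n) - R * (a * c + n)) * (b * b * (a * c + n) - R * (b * c + n)))
          ≡⟨ lemma₂ n a b c ⟩
        - (n * n * ((a * (b + c - a) + n) * (b * (a + c - b) + n))) ∎)
        where
        open ≡-Reasoning
        R = a * b + n
        lemma₁ : ∀ a b r s t →
          - ((a * t - r * s) * (b * s - r * t)) * ((a * t + r * s) * (b * s + r * t))
          ≡ - ((a * a * (t * t) - r * r * (s * s)) * (b * b * (s * s) - r * r * (t * t)))
        lemma₁ = solve-∀
        lemma₂ : ∀ n a b c →
          - ((a * a * (b * c + n) - (a * b + n) * (a * c + n))
             * (b * b * (a * c + n) - (a * b + n) * (b * c + n)))
          ≡ - (n * n * ((a * (b + c - a) + n) * (b * (a + c - b) + n)))
        lemma₂ = solve-∀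

    -- If `e ≤ -1`, then x² = ae + n² ≤ n² - a < 0.
    0≤e : 0ℤ ≤ e
    0≤e with 0ℤ ≤? e
    ... | yes h = h
    ... | no  h = absurd (by (sym x²) (0≤square x))
                    (by (lemma n a e) (α ⊕ 0≤a ⊗ <⇒0≤ (≰⇒> h)))
      where
      lemma : ∀ n a e → - (a * e + n * n) - 1ℤ ≡ (a - n * n - 1ℤ) + a * (0ℤ - e - 1ℤ)
      lemma = solve-∀

    -- With `e = 0` both x² and y² equal n², so (xy)² = n⁴. The sign of `x * y` selects xy = n², and
    -- the factor n² cancels from `n²c`.
    regular : e ≡ 0ℤ → c ≡ a + b + + 2 * r
    regular e≡0 = ≤-antisym (0≤i-j⇒j≤i (cancel d≤0)) (0≤i-j⇒j≤i (cancel d≥0))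
      where
      xy² : (x * y) * (x * y) ≡ (n * n) * (n * n)
      xy² = begin
        (x * y) * (x * y)                      ≡⟨ lemma₁ x y ⟩
        (x * x) * (y * y)                      ≡⟨ cong₂ _*_ x² y² ⟩
        (a * e + n * n) * (b * e + n * n)
          ≡⟨ cong (λ e → (a * e + n * n) * (b * e + n * n)) e≡0 ⟩
        (a * 0ℤ + n * n) * (b * 0ℤ + n * n)    ≡⟨ lemma₂ a b (n * n) ⟩
        (n * n) * (n * n)                      ∎
        where
        open ≡-Reasoning
        lemma₁ : ∀ x y → (x * y) * (x * y) ≡ (x * x) * (y * y)
        lemma₁ = solve-∀
        lemma₂ : ∀ a b m → (a * 0ℤ + m) * (b * 0ℤ + m) ≡ m * m
        lemma₂ = solve-∀
      xy≡n² : x * y ≡ n * n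
      xy≡n² = ≤-antisym
        (0≤i-j⇒j≤i (square-cancel-≤ 0≤n² (by (i≡j⇒i-j≡0 (sym xy²)) ≤-refl)))
        (0≤i-j⇒j≤i (square-cancel-≤ 0≤xy (by (i≡j⇒i-j≡0 xy²) ≤-refl)))
      eq : n * n * c ≡ n * n * (a + b + + 2 * r)
      eq = begin
        n * n * c
          ≡⟨ n²c ⟩
        n * n * (a + b) + (n + + 2 * a * b) * e + + 2 * (r * (x * y))
          ≡⟨ cong₂ (λ p q → n * n * (a + b) + (n + + 2 * a * b) * p + + 2 * (r * q)) e≡0 xy≡n² ⟩
        n * n * (a + b) + (n + + 2 * a * b) * 0ℤ + + 2 * (r * (n * n))
          ≡⟨ lemma (n * n) (a + b) (n + + 2 * a * b) r ⟩
        n * n * (a + b + + 2 * r) ∎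
        where
        open ≡-Reasoning
        lemma : ∀ m p q r → m * p + q * 0ℤ + + 2 * (r * m) ≡ m * (p + + 2 * r)
        lemma = solve-∀
      cancel : ∀ {q} → 0ℤ ≤ n * n * q → 0ℤ ≤ q
      cancel = *-cancelˡ-0≤ (n * n) (1≤n² n)
      distrib : ∀ m p q → m * (p - q) ≡ m * p - m * q
      distrib = solve-∀
      d≤0 : 0ℤ ≤ n * n * (a + b + + 2 * r - c)
      d≤0 = by (trans (distrib (n * n) _ c) (i≡j⇒i-j≡0 (sym eq))) ≤-refl
      d≥0 : 0ℤ ≤ n * n * (c - (a + b + + 2 * r))
      d≥0 = by (trans (distrib (n * n) c _) (i≡j⇒i-j≡0 eq)) ≤-refl

    -- From ab + n ≥ n²b, ae + n² ≥ 2n² and be + n² ≥ b we get (rxy)² ≥ 2(n²b)², and √2 > 4/3.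
    irregular : 0ℤ ≤ e - 1ℤ → 0ℤ ≤ + 3 * c - + 17 * b
    -- Here 17 = 3 + 6 + 8: in 3n²c the summand 3n²(a + b) gives 3n²b, `main` gives 3 · 2n²b and
    -- `rxy` gives 2 · 4n²b.
    irregular ε = *-cancelˡ-0≤ (n * n) (1≤n² n)
      (by eq (0≤n² ⊗ 0≤a ⊗ 0≤+ 3 ⊕ 0≤+ 3 ⊗ main ⊕ 0≤+ 2 ⊗ rxy))
      where
      b+n : 0ℤ ≤ b + n
      b+n = by (lemma n a b) (α ⊕ ν ⊕ β ⊕ 0≤+ 2)
        where
        lemma : ∀ n a b → b + n ≡ (a - n * n - 1ℤ) + (n * n + n) + (b - a - 1ℤ) + + 2
        lemma = solve-∀
      main : 0ℤ ≤ (n + + 2 * a * b) * e - + 2 * (n * n * b)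
      main = by (lemma n a b e)
        ((b+n ⊕ 0≤b ⊕ 0≤+ 2 ⊗ (α ⊗ 0≤b))
         ⊕ (b+n ⊕ 0≤b ⊕ 0≤+ 2 ⊗ (0≤n² ⊗ 0≤b) ⊕ 0≤+ 2 ⊗ (α ⊗ 0≤b)) ⊗ ε)
        where
        lemma : ∀ n a b e → (n + + 2 * a * b) * e - + 2 * (n * n * b)
          ≡ ((b + n) + b + + 2 * ((a - n * n - 1ℤ) * b))
            + ((b + n) + b + + 2 * (n * n * b) + + 2 * ((a - n * n - 1ℤ) * b)) * (e - 1ℤ)
        lemma = solve-∀
      p : 0ℤ ≤ (a * b + n) - n * n * b
      p = by (lemma n a b) (b+n ⊕ α ⊗ 0≤b)
        where
        lemma : ∀ n a b → (a * b + n) - n * n * b ≡ (b + n) + (a - n * n - 1ℤ) * b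
        lemma = solve-∀
      q : 0ℤ ≤ (a * e + n * n) - + 2 * (n * n)
      q = by (lemma n a e) (α ⊕ 0≤a ⊗ ε ⊕ 0≤+ 1)
        where
        lemma : ∀ n a e → (a * e + n * n) - + 2 * (n * n) ≡ (a - n * n - 1ℤ) + a * (e - 1ℤ) + 1ℤ
        lemma = solve-∀
      u : 0ℤ ≤ (b * e + n * n) - b
      u = by (lemma (n * n) b e) (0≤b ⊗ ε ⊕ 0≤n²)
        where
        lemma : ∀ m b e → (b * e + m) - b ≡ b * (e - 1ℤ) + m
        lemma = solve-∀
      rxy : 0ℤ ≤ + 3 * (r * (x * y)) - + 4 * (n * n * b)
      -- The three factors of (rxy)² are replaced by their lower bounds n²b, 2n² and b one at a
      -- time; 9 · 2 - 16 leaves 2(n²b)².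
      rxy = square-cancel-≤ (0≤+ 3 ⊗ (0≤r ⊗ 0≤xy)) (by squares
        (0≤+ 9 ⊗ (p ⊗ (Y ⊗ Z) ⊕ 0≤n² ⊗ 0≤b ⊗ (q ⊗ Z) ⊕ 0≤n² ⊗ 0≤b ⊗ (0≤+ 2 ⊗ 0≤n²) ⊗ u)
         ⊕ 0≤+ 2 ⊗ (0≤n² ⊗ 0≤b ⊗ (0≤n² ⊗ 0≤b))))
        where
        Y : 0ℤ ≤ a * e + n * n
        Y = by (sym x²) (0≤square x)
        Z : 0ℤ ≤ b * e + n * n
        Z = by (sym y²) (0≤square y)
        squares : + 3 * (r * (x * y)) * (+ 3 * (r * (x * y))) - + 4 * (n * n * b) * (+ 4 * (n * n * b))
          ≡ + 9 * (((a * b + n) - n * n * b) * ((a * e + n * n) * (b * e + n * n))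
                   + n * n * b * (((a * e + n * n) - + 2 * (n * n)) * (b * e + n * n))
                   + n * n * b * (+ 2 * (n * n)) * ((b * e + n * n) - b))
            + + 2 * (n * n * b * (n * n * b))
        squares = begin
          + 3 * (r * (x * y)) * (+ 3 * (r * (x * y))) - + 4 * (n * n * b) * (+ 4 * (n * n * b))
            ≡⟨ lemma₁ r x y (n * n * b) ⟩
          + 9 * (r * r * (x * x * (y * y))) - + 16 * (n * n * b * (n * n * b))
            ≡⟨ cong (λ z → + 9 * z - + 16 * (n * n * b * (n * n * b)))
                 (cong₂ _*_ r² (cong₂ _*_ x² y²)) ⟩
          + 9 * ((a * b + n) * ((a * e + n * n) * (b * e + n * n))) - + 16 * (n * n * b * (n * n * b))
            ≡⟨ lemma₂ (a * b + n) (a * e + n * n) (b * e + n * n) (n * n) b ⟩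
          _ ∎
          where
          open ≡-Reasoning
          lemma₁ : ∀ r x y z → + 3 * (r * (x * y)) * (+ 3 * (r * (x * y))) - + 4 * z * (+ 4 * z)
            ≡ + 9 * (r * r * (x * x * (y * y))) - + 16 * (z * z)
          lemma₁ = solve-∀
          lemma₂ : ∀ X Y Z m b → + 9 * (X * (Y * Z)) - + 16 * (m * b * (m * b))
            ≡ + 9 * ((X - m * b) * (Y * Z) + m * b * ((Y - + 2 * m) * Z)
                     + m * b * (+ 2 * m) * (Z - b))
              + + 2 * (m * b * (m * b))
          lemma₂ = solve-∀
      eq : n * n * (+ 3 * c - + 17 * b)
        ≡ n * n * a * + 3 + + 3 * ((n + + 2 * a * b) * e - + 2 * (n * n * b))
          + + 2 * (+ 3 * (r * (x * y)) - + 4 * (n * n * b))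
      eq = begin
        n * n * (+ 3 * c - + 17 * b)
          ≡⟨ lemma₁ (n * n) b c ⟩
        + 3 * (n * n * c) - + 17 * (n * n * b)
          ≡⟨ cong (λ z → + 3 * z - + 17 * (n * n * b)) n²c ⟩
        + 3 * (n * n * (a + b) + (n + + 2 * a * b) * e + + 2 * (r * (x * y))) - + 17 * (n * n * b)
          ≡⟨ lemma₂ (n * n) a b ((n + + 2 * a * b) * e) (r * (x * y)) ⟩
        _ ∎
        where
        open ≡-Reasoning
        lemma₁ : ∀ m b c → m * (+ 3 * c - + 17 * b) ≡ + 3 * (m * c) - + 17 * (m * b)
        lemma₁ = solve-∀
        lemma₂ : ∀ m a b z w → + 3 * (m * (a + b) + z + + 2 * w) - + 17 * (m * b)
          ≡ m * a * + 3 + + 3 * (z - + 2 * (m * b)) + + 2 * (+ 3 * w - + 4 * (m * b))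
        lemma₂ = solve-∀

  dichotomy : c ≡ a + b + + 2 * r ⊎ 0ℤ ≤ + 3 * c - + 17 * b
  dichotomy with e ≟ 0ℤ
  ... | yes e≡0 = inj₁ (regular e≡0)
  ... | no  e≢0 = inj₂ (irregular
    (by (cong (_- 1ℤ) (sym (+-identityʳ e))) (<⇒0≤ (≤∧≢⇒< 0≤e (≢-sym e≢0)))))

-- Gaps in sets with property D(n), and their iteration.

-- The recursion goes by twos because two gaps of ratio 17/3 give 289/9, just above the integer 32.
-- The value 0 for at most two elements is the trivial bound.
growth : ℕ → ℕ
growth 0 = 0
growth 1 = 0
growth 2 = 0
growth 3 = 4
growth 4 = 21
growth (suc (suc m@(suc (suc (suc _))))) = 32 ℕ.* growth m

growth-suc : ∀ m → growth m ℕ.≤ growth (suc m)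
growth-suc 0 = z≤n
growth-suc 1 = z≤n
growth-suc 2 = z≤n
growth-suc 3 = ℕₚ.m≤m+n 4 17
growth-suc 4 = ℕₚ.m≤m+n 21 107
growth-suc (suc (suc m@(suc (suc (suc _))))) = ℕₚ.*-monoʳ-≤ 32 (growth-suc m)

growth-mono : ∀ {k m} → k ℕ.≤ m → growth k ℕ.≤ growth m
growth-mono k≤m = go (ℕₚ.≤⇒≤′ k≤m)
  where
  go : ∀ {k m} → k ℕ.≤′ m → growth k ℕ.≤ growth m
  go ℕ.≤′-refl         = ℕₚ.≤-refl
  go (ℕ.≤′-step {m} h) = ℕₚ.≤-trans (go h) (growth-suc m)

scale-≤ : ∀ i a j b → 0ℤ ≤ + i * + a - + j * + b → j ℕ.* b ℕ.≤ i ℕ.* a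
scale-≤ i a j b h =
  drop‿+≤+ (subst₂ _≤_ (sym (pos-* j b)) (sym (pos-* i a)) (0≤i-j⇒j≤i h))

module _ {n : ℤ} .{{_ : NonZero n}} where

  D : ℤ → ℤ → Set
  D a b = IsSquare (a * b + n)

  -- In the regular case c = a + b + 2r with b > a, and r ≥ a because ab + n ≥ a² + a + n > a².
  -- Otherwise 3c ≥ 17b > 12a.
  triple-gap : ∀ {a b c} → n * n ℤ.< a → a ℤ.< b → b ℤ.< c → D a b → D a c → D b c →
               0ℤ ≤ c - + 4 * a
  triple-gap {a} {b} {c} n²<a a<b b<c ab ac bc with nonNegRoot ab
  ... | r , hr with Triple.dichotomy n²<a a<b b<c hr
                      (proj₂ (nonNegRoot ac)) (proj₂ (nonNegRoot bc))
  ... | inj₁ refl = by (lemma₁ a b r)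
      (<⇒0≤ a<b ⊕ 0≤+ 2 ⊗ a≤r ⊕ 0≤+ 1)
    where
    lemma₁ : ∀ a b r → a + b + + 2 * r - + 4 * a ≡ (b - a - 1ℤ) + + 2 * (r - a) + 1ℤ
    lemma₁ = solve-∀
    lemma₂ : ∀ n a b → (a * b + n) - a * a
      ≡ a * (b - a - 1ℤ) + (a - n * n - 1ℤ) + (n * n + n) + 1ℤ
    lemma₂ = solve-∀
    0≤a = ≤-trans (0≤square n) (<⇒≤ n²<a)
    a≤r : 0ℤ ≤ r - a
    a≤r = square-cancel-≤ (IsRoot.nonneg hr)
      (by (trans (cong (_- a * a) (IsRoot.root hr)) (lemma₂ n a b))
          (0≤a ⊗ <⇒0≤ a<b ⊕ <⇒0≤ n²<a ⊕ 0≤n²+n n ⊕ 0≤+ 1))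
  ... | inj₂ h = *-cancelˡ-0≤ (+ 3) (+≤+ z≤n) (by (lemma a b c)
      (h ⊕ 0≤+ 17 ⊗ <⇒0≤ a<b ⊕ 0≤+ 5 ⊗ 0≤a ⊕ 0≤+ 17))
    where
    lemma : ∀ a b c → + 3 * (c - + 4 * a)
      ≡ (+ 3 * c - + 17 * b) + + 17 * (b - a - 1ℤ) + + 5 * a + + 17
    lemma = solve-∀
    0≤a = ≤-trans (0≤square n) (<⇒≤ n²<a)

  -- Two regular extensions d = a + c + 2s and d = b + c + 2t would contradict a < b.
  quadruple-gap : ∀ {a b c d} → n * n ℤ.< a → a ℤ.< b → b ℤ.< c → c ℤ.< d →
                  D a c → D a d → D b c → D b d → D c d →
                  0ℤ ≤ + 3 * d - + 17 * c
  quadruple-gap {a} {b} {c} {d} n²<a a<b b<c c<d ac ad bc bd cd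
    with nonNegRoot ac | nonNegRoot bc
  ... | s , hs | t , ht
    -- The triples (a, c, d) and (b, c, d) share the middle element `c`, so a single irregular one
    -- suffices.
    with Triple.dichotomy n²<a (<-trans a<b b<c) c<d hs
           (proj₂ (nonNegRoot ad)) (proj₂ (nonNegRoot cd))
       | Triple.dichotomy (<-trans n²<a a<b) b<c c<d ht
           (proj₂ (nonNegRoot bd)) (proj₂ (nonNegRoot cd))
  ... | inj₂ h  | _       = h
  ... | inj₁ _  | inj₂ h  = h
  ... | inj₁ d₁ | inj₁ d₂ = absurd (by (lemma₁ a b c s t)
        (<⇒0≤ a<b ⊕ 0≤+ 2 ⊗ s≤t)) (by (cong (λ z → - z - 1ℤ) eq) ≤-refl)
    where
    lemma₁ : ∀ a b c s t → (b + c + + 2 * t) - (a + c + + 2 * s) - 1ℤ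
      ≡ (b - a - 1ℤ) + + 2 * (t - s)
    lemma₁ = solve-∀
    eq : (b + c + + 2 * t) - (a + c + + 2 * s) - 1ℤ ≡ -1ℤ
    eq = cong (_- 1ℤ) (i≡j⇒i-j≡0 (trans (sym d₂) d₁))
    lemma₂ : ∀ n a b c → (b * c + n) - (a * c + n) ≡ (b - a - 1ℤ) * c + c
    lemma₂ = solve-∀
    0≤c = ≤-trans (0≤square n) (<⇒≤ (<-trans n²<a (<-trans a<b b<c)))
    s≤t : 0ℤ ≤ t - s
    s≤t = square-cancel-≤ (IsRoot.nonneg ht)
      (by (trans (cong₂ _-_ (IsRoot.root ht) (IsRoot.root hs)) (lemma₂ n a b c))
          (<⇒0≤ a<b ⊗ 0≤c ⊕ 0≤c))

  +∣n∣² : + (∣ n ∣ ℕ.^ 2) ≡ n * n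
  +∣n∣² = begin
    + (∣ n ∣ ℕ.* (∣ n ∣ ℕ.* 1))  ≡⟨ cong (λ k → + (∣ n ∣ ℕ.* k)) (ℕₚ.*-identityʳ ∣ n ∣) ⟩
    + (∣ n ∣ ℕ.* ∣ n ∣)          ≡⟨ cong +_ (abs-* n n) ⟨
    + ∣ n * n ∣                  ≡⟨ 0≤i⇒+∣i∣≡i (0≤square n) ⟩
    n * n                        ∎
    where open ≡-Reasoning

  private
    n²<+ : ∀ {a} → ∣ n ∣ ℕ.^ 2 ℕ.< a → n * n ℤ.< + a
    n²<+ h = subst (ℤ._< _) +∣n∣² (+<+ h)

  infix 4 _≻_
  -- Lists are descending, so that the head is the element to be bounded and removing the two
  -- largest elements leaves a tail for the induction.
  _≻_ : ℕ → ℕ → Set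
  b ≻ a = a ℕ.< b × D (+ a) (+ b)

  first≥4third : ∀ {x y z} → ∣ n ∣ ℕ.^ 2 ℕ.< z → y ≻ z → x ≻ z → x ≻ y → 4 ℕ.* z ℕ.≤ x
  first≥4third {x} {y} {z} n²<z (z<y , yz) (_ , xz) (y<x , xy) = subst (_ ℕ.≤_) (ℕₚ.*-identityˡ x)
    (scale-≤ 1 x 4 z (by (cong (_- + 4 * + z) (*-identityˡ (+ x)))
      (triple-gap (n²<+ n²<z) (+<+ z<y) (+<+ y<x) yz xz xy)))

  first≥17/3second : ∀ {w x y z} → ∣ n ∣ ℕ.^ 2 ℕ.< z → AllPairs _≻_ (w ∷ x ∷ y ∷ z ∷ []) →
                     17 ℕ.* x ℕ.≤ 3 ℕ.* w
  first≥17/3second {w} {x} n²<z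
    (((x<w , wx) ∷ (_ , wy) ∷ (_ , wz) ∷ []) ∷ ((y<x , xy) ∷ (_ , xz) ∷ []) ∷ ((z<y , _) ∷ []) ∷ _) =
    scale-≤ 3 w 17 x (quadruple-gap (n²<+ n²<z) (+<+ z<y) (+<+ y<x) (+<+ x<w) xz wz xy wy wx)

  -- For five or more elements, the quadruples w > x > y > z and x > y > z > v give 9w ≥ 51x ≥ 289y
  -- ≥ 9 · 32y, and induction applies to the list from `y` on.
  growth-bound : ∀ x xs → All (∣ n ∣ ℕ.^ 2 ℕ.<_) (x ∷ xs) → AllPairs _≻_ (x ∷ xs) →
                 growth (length (x ∷ xs)) ℕ.* ∣ n ∣ ℕ.^ 2 ℕ.≤ x
  growth-bound w []  _ _ = z≤n
  growth-bound w (x ∷ []) _ _ = z≤n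
  growth-bound w (x ∷ y ∷ []) (_ ∷ _ ∷ n²<y ∷ []) ((wx ∷ wy ∷ []) ∷ (xy ∷ []) ∷ _) =
    ℕₚ.≤-trans (ℕₚ.*-monoʳ-≤ 4 (ℕₚ.<⇒≤ n²<y)) (first≥4third n²<y xy wy wx)
  growth-bound w (x ∷ y ∷ z ∷ []) (_ ∷ _ ∷ _ ∷ n²<z ∷ []) ps@(_ ∷ (xy ∷ xz ∷ []) ∷ (yz ∷ []) ∷ _) =
    ℕₚ.*-cancelˡ-≤ 3 (begin
      3 ℕ.* (21 ℕ.* M)    ≡⟨ ℕₚ.*-assoc 3 21 M ⟨
      -- The gaps give 4 · 17/3 = 68/3, rounded down to 21 = 63/3.
      63 ℕ.* M            ≤⟨ ℕₚ.*-mono-≤ (ℕₚ.m≤m+n 63 5) (ℕₚ.<⇒≤ n²<z) ⟩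
      68 ℕ.* z            ≡⟨ ℕₚ.*-assoc 17 4 z ⟩
      17 ℕ.* (4 ℕ.* z)    ≤⟨ ℕₚ.*-monoʳ-≤ 17 (first≥4third n²<z yz xz xy) ⟩
      17 ℕ.* x            ≤⟨ first≥17/3second n²<z ps ⟩
      3 ℕ.* w             ∎)
    where
    open ℕₚ.≤-Reasoning
    M = ∣ n ∣ ℕ.^ 2
  growth-bound w (x ∷ y ∷ z ∷ v ∷ vs) (_ ∷ _ ∷ n²<′@(_ ∷ n²<z ∷ n²<v ∷ _))
    (((wx ∷ wy ∷ wz ∷ _)) ∷ ps@((xy ∷ xz ∷ xv ∷ _) ∷ ps′@((yz ∷ yv ∷ _) ∷ (zv ∷ _) ∷ _))) =
    ℕₚ.*-cancelˡ-≤ 9 (begin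
      9 ℕ.* (32 ℕ.* g ℕ.* M)   ≡⟨ cong (9 ℕ.*_) (ℕₚ.*-assoc 32 g M) ⟩
      9 ℕ.* (32 ℕ.* (g ℕ.* M)) ≤⟨ ℕₚ.*-monoʳ-≤ 9 (ℕₚ.*-monoʳ-≤ 32 (growth-bound y (z ∷ v ∷ vs) n²<′ ps′)) ⟩
      9 ℕ.* (32 ℕ.* y)         ≡⟨ ℕₚ.*-assoc 9 32 y ⟨
      288 ℕ.* y                ≤⟨ ℕₚ.*-monoˡ-≤ y (ℕₚ.m≤m+n 288 1) ⟩
      289 ℕ.* y                ≡⟨ ℕₚ.*-assoc 17 17 y ⟩
      17 ℕ.* (17 ℕ.* y)        ≤⟨ ℕₚ.*-monoʳ-≤ 17 (first≥17/3second n²<v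
                                    ((xy ∷ xz ∷ xv ∷ []) ∷ (yz ∷ yv ∷ []) ∷ (zv ∷ []) ∷ [] ∷ [])) ⟩
      17 ℕ.* (3 ℕ.* x)         ≡⟨ ℕₚ.*-assoc 17 3 x ⟨
      51 ℕ.* x                 ≡⟨ ℕₚ.*-assoc 3 17 x ⟩
      3 ℕ.* (17 ℕ.* x)         ≤⟨ ℕₚ.*-monoʳ-≤ 3 (first≥17/3second n²<z
                                    ((wx ∷ wy ∷ wz ∷ []) ∷ (xy ∷ xz ∷ []) ∷ (yz ∷ []) ∷ [] ∷ [])) ⟩
      3 ℕ.* (3 ℕ.* w)          ≡⟨ ℕₚ.*-assoc 3 3 w ⟨
      9 ℕ.* w                  ∎)
    where
    open ℕₚ.≤-Reasoning
    M = ∣ n ∣ ℕ.^ 2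
    g = growth (length (y ∷ z ∷ v ∷ vs))

  private
    ≥-decTotalOrder = Flip.decTotalOrder ℕₚ.≤-decTotalOrder

    D-sym : ∀ {a b} → D (+ a) (+ b) → D (+ b) (+ a)
    D-sym {a} {b} = subst (λ z → IsSquare (z + n)) (*-comm (+ a) (+ b))

  -- Distinctness and `D` are symmetric, hence survive the reordering; combined with sortedness they
  -- give strict descent.
  descending : ∀ {xs} → AllPairs _≢_ xs → AllPairs (λ a b → D (+ a) (+ b)) xs →
               ∃ λ ys → ys ↭ xs × AllPairs _≻_ ys
  descending {xs} u d = sort xs , sort-↭ xs ,
    AllPairs.zipWith (λ {b} {a} ((a≤b , b≢a) , ba) → ℕₚ.≤∧≢⇒< a≤b (≢-sym b≢a) , D-sym {b} {a} ba)
      (AllPairs.zip (sorted , respects ≢-sym u) , respects (λ {a} {b} → D-sym {a} {b}) d)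
    where
    open Sort ≥-decTotalOrder
    sorted : AllPairs ℕ._≥_ (sort xs)
    sorted = Sortedₚ.Sorted⇒AllPairs (DecTotalOrder.totalOrder ≥-decTotalOrder) (sort-↗ xs)
    respects : ∀ {R : ℕ → ℕ → Set} → (∀ {a b} → R a b → R b a) →
               AllPairs R xs → AllPairs R (sort xs)
    respects {R} R-sym = ↭ₛ.AllPairs-resp-↭ (setoid ℕ) R-sym
      ((λ { refl → λ h → h }) , (λ { refl → λ h → h })) (↭⇒↭ₛ (↭-sym (sort-↭ xs)))

  -- The largest element lies below |n|³ and is at least n² times the growth value, so n² cancels.
  growth-count : ∀ {S} → HasD n S → growth (count n S) ℕ.≤ ∣ n ∣
  growth-count {S} (mkHasD u _ d)
    with descending (AllPairsₚ.filter⁺ (inInterval? n) u) (AllPairsₚ.filter⁺ (inInterval? n) d)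
  ... | ys , ys↭ , ps = subst (λ m → growth m ℕ.≤ ∣ n ∣) (↭-length ys↭)
          (go ys (All-resp-↭ (↭-sym ys↭) (Allₚ.all-filter (inInterval? n) S)) ps)
    where
    go : ∀ ys → All (InInterval n) ys → AllPairs _≻_ ys → growth (length ys) ℕ.≤ ∣ n ∣
    go []       _  _  = z≤n
    go (y ∷ ys) is@(i ∷ _) ps = ℕₚ.*-cancelʳ-≤ _ _ (∣ n ∣ ℕ.^ 2) {{ℕₚ.m^n≢0 ∣ n ∣ 2}}
      (ℕₚ.≤-trans (growth-bound y ys (All.map proj₁ is) ps) (ℕₚ.<⇒≤ (proj₂ i)))

-- No set attaining the supremum is extracted: if |n| < `growth (suc b)`, monotonicity keeps every
-- count at most `b`, contradicting the leastness of `suc b`.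
growth-B : ∀ n .{{_ : NonZero n}} → growth (B n) ℕ.≤ ∣ n ∣
growth-B n with B n | IsSup.least (B-isSup n)
... | zero  | _     = z≤n
... | suc b | least = ℕₚ.≮⇒≥ λ n<g → contradiction
  (least (λ { (S , h , refl) → ℕₚ.≤-pred (ℕₚ.≰⇒> λ b<k →
    ℕₚ.<⇒≱ n<g (ℕₚ.≤-trans (growth-mono b<k) (growth-count h))) }))
  ℕₚ.1+n≰n

-- Numerical lower bounds for logarithms.

cast : ℕ → ℚ
cast m = + m / 1

-- As a sum of ones, `cast` inherits its arithmetic from `∑-split` and `∑-blocks`, without computing
-- with normalised fractions.
cast≡∑ : ∀ m → cast m ≡ ∑ m (λ _ → 1ℚ)
cast≡∑ m = sym (trans (∑-const m 1ℚ) (ℚₚ.*-identityʳ (cast m)))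

cast-+ : ∀ m k → cast (m ℕ.+ k) ≡ cast m ℚ.+ cast k
cast-+ m k = begin
  cast (m ℕ.+ k)                                 ≡⟨ cast≡∑ (m ℕ.+ k) ⟩
  ∑ (m ℕ.+ k) (λ _ → 1ℚ)                         ≡⟨ ∑-split m k _ ⟩
  ∑ m (λ _ → 1ℚ) ℚ.+ ∑ k (λ _ → 1ℚ)              ≡⟨ cong₂ ℚ._+_ (cast≡∑ m) (cast≡∑ k) ⟨
  cast m ℚ.+ cast k                              ∎
  where open ≡-Reasoning

cast-* : ∀ m k → cast (m ℕ.* k) ≡ cast m ℚ.* cast k
cast-* m k = begin
  cast (m ℕ.* k)                     ≡⟨ cong cast (ℕₚ.*-comm m k) ⟩
  cast (k ℕ.* m)                     ≡⟨ cast≡∑ (k ℕ.* m) ⟩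
  ∑ (k ℕ.* m) (λ _ → 1ℚ)             ≡⟨ ∑-blocks k m _ ⟩
  ∑ m (λ _ → ∑ k (λ _ → 1ℚ))         ≡⟨ ∑-cong m (λ _ → cast≡∑ k) ⟨
  ∑ m (λ _ → cast k)                 ≡⟨ ∑-const m (cast k) ⟩
  cast m ℚ.* cast k                  ∎
  where open ≡-Reasoning

∑-nonNeg : ∀ m {f} → (∀ i → 0ℚ ℚ.≤ f i) → 0ℚ ℚ.≤ ∑ m f
∑-nonNeg zero    h = ℚₚ.≤-refl
∑-nonNeg (suc m) h = ℚₚ.+-mono-≤ (∑-nonNeg m h) (h m)

∑-monoˡ : ∀ {m k f} → (∀ i → 0ℚ ℚ.≤ f i) → m ℕ.≤ k → ∑ m f ℚ.≤ ∑ k f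
∑-monoˡ {m} {k} {f} h m≤k = begin
  ∑ m f                                        ≡⟨ ℚₚ.+-identityʳ (∑ m f) ⟨
  ∑ m f ℚ.+ 0ℚ                                 ≤⟨ ℚₚ.+-monoʳ-≤ (∑ m f)
                                                    (∑-nonNeg (k ℕ.∸ m) (λ i → h (m ℕ.+ i))) ⟩
  ∑ m f ℚ.+ ∑ (k ℕ.∸ m) (λ i → f (m ℕ.+ i))    ≡⟨ ∑-split m (k ℕ.∸ m) f ⟨
  ∑ (m ℕ.+ (k ℕ.∸ m)) f                        ≡⟨ cong (λ z → ∑ z f) (ℕₚ.m+[n∸m]≡n m≤k) ⟩
  ∑ k f                                        ∎
  where open ℚₚ.≤-Reasoning

cast-mono-≤ : ∀ {m k} → m ℕ.≤ k → cast m ℚ.≤ cast k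
cast-mono-≤ {m} {k} m≤k = subst₂ ℚ._≤_ (sym (cast≡∑ m)) (sym (cast≡∑ k))
  (∑-monoˡ (λ _ → ℚₚ.nonNegative⁻¹ 1ℚ) m≤k)

logSum-mono : ∀ {M N} k → M ℕ.≤ N → logSum M k ℚ.≤ logSum N k
logSum-mono k M≤N = ∑-monoˡ (λ i → recip-nonNeg (suc k ℕ.+ i))
  (ℕₚ.*-monoˡ-≤ (suc k) (ℕₚ.∸-monoˡ-≤ 1 M≤N))

-- ∫₁ᴺ dt/t = ∫_M^{MN} dt/t, and the partition used on the right is the finer one.
logSum-* : ∀ M N .{{_ : ℕ.NonZero M}} .{{_ : ℕ.NonZero N}} k →
           logSum M k ℚ.+ logSum N k ℚ.≤ logSum (M ℕ.* N) k
logSum-* (suc M) (suc N) k = begin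
  logSum (suc M) k ℚ.+ logSum (suc N) k
    ≤⟨ ℚₚ.+-monoʳ-≤ (logSum (suc M) k) (refine-lower M (N ℕ.* suc k) (suc k)) ⟩
  logSum (suc M) k ℚ.+ ∑ (suc M ℕ.* (N ℕ.* suc k)) (λ i → recip (suc M ℕ.* suc k ℕ.+ i))
    ≡⟨ cong (logSum (suc M) k ℚ.+_) (∑-cong (suc M ℕ.* (N ℕ.* suc k))
         (λ i → cong recip (ℕₚ.+-assoc (suc k) (M ℕ.* suc k) i))) ⟩
  logSum (suc M) k ℚ.+ ∑ (suc M ℕ.* (N ℕ.* suc k)) (λ i → recip (suc k ℕ.+ (M ℕ.* suc k ℕ.+ i)))
    ≡⟨ ∑-split (M ℕ.* suc k) (suc M ℕ.* (N ℕ.* suc k)) (λ i → recip (suc k ℕ.+ i)) ⟨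
  ∑ (M ℕ.* suc k ℕ.+ suc M ℕ.* (N ℕ.* suc k)) (λ i → recip (suc k ℕ.+ i))
    ≡⟨ cong (λ z → ∑ z (λ i → recip (suc k ℕ.+ i))) (size M N (suc k)) ⟩
  logSum (suc M ℕ.* suc N) k ∎
  where
  open ℚₚ.≤-Reasoning
  size : ∀ M N k → M ℕ.* k ℕ.+ suc M ℕ.* (N ℕ.* k) ≡ (N ℕ.+ M ℕ.* suc N) ℕ.* k
  size = ℕ-solve-∀

cast-recip : ∀ a → cast (suc a) ℚ.* recip a ≡ 1ℚ
cast-recip a = sym (trans (recip-scale a 0)
  (cong (λ z → cast (suc a) ℚ.* recip z) (trans (cong (a ℕ.+_) (ℕₚ.*-zeroʳ (suc a))) (ℕₚ.+-identityʳ a))))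

-- D-fold Riemann sums rounded down termwise, so that numerical lower bounds for logarithms
-- are evaluated in ℕ.
floorSum : ℕ → ℕ → ℕ → ℕ
floorSum D a zero    = 0
floorSum D a (suc m) = floorSum D a m ℕ.+ D ℕ./ suc (a ℕ.+ m)

floorSum-≤ : ∀ D a m → cast (floorSum D a m) ℚ.≤ cast D ℚ.* ∑ m (λ i → recip (a ℕ.+ i))
floorSum-≤ D a zero    = ℚₚ.≤-reflexive (sym (ℚₚ.*-zeroʳ (cast D)))
floorSum-≤ D a (suc m) = begin
  cast (floorSum D a m ℕ.+ q)
    ≡⟨ cast-+ (floorSum D a m) q ⟩
  cast (floorSum D a m) ℚ.+ cast q
    ≤⟨ ℚₚ.+-mono-≤ (floorSum-≤ D a m) term ⟩
  cast D ℚ.* ∑ m (λ i → recip (a ℕ.+ i)) ℚ.+ cast D ℚ.* recip b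
    ≡⟨ ℚₚ.*-distribˡ-+ (cast D) _ (recip b) ⟨
  cast D ℚ.* ∑ (suc m) (λ i → recip (a ℕ.+ i)) ∎
  where
  open ℚₚ.≤-Reasoning
  b = a ℕ.+ m
  q = D ℕ./ suc b
  term : cast q ℚ.≤ cast D ℚ.* recip b
  term = begin
    cast q                                ≡⟨ ℚₚ.*-identityʳ (cast q) ⟨
    cast q ℚ.* 1ℚ                         ≡⟨ cong (cast q ℚ.*_) (cast-recip b) ⟨
    cast q ℚ.* (cast (suc b) ℚ.* recip b) ≡⟨ ℚₚ.*-assoc (cast q) (cast (suc b)) (recip b) ⟨
    cast q ℚ.* cast (suc b) ℚ.* recip b   ≡⟨ cong (ℚ._* recip b) (cast-* q (suc b)) ⟨
    cast (q ℕ.* suc b) ℚ.* recip b        ≤⟨ ℚₚ.*-monoʳ-≤-nonNeg (recip b) {{ℚ.nonNegative (recip-nonNeg b)}}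
                                               (cast-mono-≤ (ℕ.m/n*n≤m D (suc b))) ⟩
    cast D ℚ.* recip b                    ∎

-- logSum N K exceeds logSum N k by at most 1/(k + 1) ≤ 1/1000.
logSum-≥ : ∀ N K D (q : ℚ) .{{_ : ℚ.Positive (cast D)}} →
  True (cast D ℚ.* (q ℚ.+ recip 999) ℚ.≤? cast (floorSum D (suc K) ((N ℕ.∸ 1) ℕ.* suc K))) →
  ∀ {k} → 999 ℕ.≤ k → q ℚ.≤ logSum N k
logSum-≥ N K D q w {k} 999≤k = subst₂ ℚ._≤_ (cancel q (recip 999)) (cancel (logSum N k) (recip 999))
  (ℚₚ.+-monoˡ-≤ (ℚ.- recip 999) (begin
    q ℚ.+ recip 999            ≤⟨ ℚₚ.*-cancelˡ-≤-pos (cast D) (ℚₚ.≤-trans (toWitness w)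
                                    (floorSum-≤ D (suc K) ((N ℕ.∸ 1) ℕ.* suc K))) ⟩
    logSum N K                 ≤⟨ logSum-close N K k ⟩
    logSum N k ℚ.+ recip k     ≤⟨ ℚₚ.+-monoʳ-≤ (logSum N k) (recip-anti 999≤k) ⟩
    logSum N k ℚ.+ recip 999   ∎))
  where
  open ℚₚ.≤-Reasoning
  cancel : ∀ a b → (a ℚ.+ b) ℚ.- b ≡ a
  cancel = solve 2 (λ a b → (a :+ b) :- b := a) refl
    where open +-*-Solver

logGrowth : ℕ → ℚ
logGrowth 0 = 0ℚ
logGrowth 1 = 0ℚ
logGrowth 2 = 0ℚ
logGrowth 3 = + 138 / 100
logGrowth 4 = + 302 / 100
logGrowth (suc (suc m@(suc (suc (suc _))))) = + 34 / 10 ℚ.+ logGrowth m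

growth-nonZero : ∀ m → ℕ.NonZero (growth (3 ℕ.+ m))
growth-nonZero 0 = _
growth-nonZero 1 = _
growth-nonZero (suc (suc m)) = ℕₚ.m*n≢0 32 (growth (3 ℕ.+ m)) {{_}} {{growth-nonZero m}}

logGrowth-≤ : ∀ m {k} → 999 ℕ.≤ k → logGrowth m ℚ.≤ logSum (growth m) k
-- Here `growth` is 0, and `logSum 0 k` is an empty sum since `0 ∸ 1` is 0.
logGrowth-≤ 0 _ = ℚₚ.≤-refl
logGrowth-≤ 1 _ = ℚₚ.≤-refl
logGrowth-≤ 2 _ = ℚₚ.≤-refl
-- The meshes are 1/200, 1/33 and 1/17, finest where the margin is smallest (log 4 is about 1.386).
-- Rounding at scale 10⁷ loses less than 10⁻⁴ in each sum.
logGrowth-≤ 3 = logSum-≥ 4 199 10000000 (+ 138 / 100) _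
logGrowth-≤ 4 = logSum-≥ 21 32 10000000 (+ 302 / 100) _
logGrowth-≤ (suc (suc m@(suc (suc (suc l))))) {k} 999≤k = begin
  + 34 / 10 ℚ.+ logGrowth m
    ≤⟨ ℚₚ.+-mono-≤ (logSum-≥ 32 16 10000000 (+ 34 / 10) _ 999≤k) (logGrowth-≤ m 999≤k) ⟩
  logSum 32 k ℚ.+ logSum (growth m) k
    ≤⟨ logSum-* 32 (growth m) {{_}} {{growth-nonZero l}} k ⟩
  logSum (32 ℕ.* growth m) k ∎
  where open ℚₚ.≤-Reasoning

-- Comparison of the number of elements with c log |n| + d.

module _ (c d : ℚ) where

  -- The summand `recip 999`, that is 1/1000, becomes the positive rational required by `_<ᵣ_`.
  Below : ℕ → Set
  Below m = cast m ℚ.+ recip 999 ℚ.≤ c ℚ.* logGrowth m ℚ.+ d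

  -- Two more elements add 2 on the left and 3.4c on the right; for c = 0.6114 and c = 0.6071 the
  -- latter exceeds 2.06.
  below-step : cast 2 ℚ.≤ c ℚ.* (+ 34 / 10) → ∀ m →
               Below (3 ℕ.+ m) → Below (5 ℕ.+ m)
  below-step h m b = begin
    cast (5 ℕ.+ m) ℚ.+ recip 999
      ≡⟨ cong (ℚ._+ recip 999) (cast-+ 2 (3 ℕ.+ m)) ⟩
    cast 2 ℚ.+ cast (3 ℕ.+ m) ℚ.+ recip 999
      ≡⟨ ℚₚ.+-assoc (cast 2) (cast (3 ℕ.+ m)) (recip 999) ⟩
    cast 2 ℚ.+ (cast (3 ℕ.+ m) ℚ.+ recip 999)
      ≤⟨ ℚₚ.+-mono-≤ h b ⟩
    c ℚ.* (+ 34 / 10) ℚ.+ (c ℚ.* logGrowth (3 ℕ.+ m) ℚ.+ d)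
      ≡⟨ ℚₚ.+-assoc (c ℚ.* (+ 34 / 10)) (c ℚ.* logGrowth (3 ℕ.+ m)) d ⟨
    c ℚ.* (+ 34 / 10) ℚ.+ c ℚ.* logGrowth (3 ℕ.+ m) ℚ.+ d
      ≡⟨ cong (ℚ._+ d) (ℚₚ.*-distribˡ-+ c (+ 34 / 10) (logGrowth (3 ℕ.+ m))) ⟨
    c ℚ.* logGrowth (5 ℕ.+ m) ℚ.+ d ∎
    where open ℚₚ.≤-Reasoning

  <ᵣ-log : .{{_ : ℚ.NonNegative c}} → ∀ {b N} m .{{_ : ℕ.NonZero N}} → b ℕ.≤ m → growth m ℕ.≤ N →
           Below m → fromℕ b <ᵣ c ·ᵣ log N +ᵣ fromℚ d
  <ᵣ-log {b} {N} m b≤m g≤N h = recip 999 , ℚₚ.positive⁻¹ (recip 999) , 999 , λ k 999≤k → begin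
    cast b ℚ.+ recip 999             ≤⟨ ℚₚ.+-monoˡ-≤ (recip 999) (cast-mono-≤ b≤m) ⟩
    cast m ℚ.+ recip 999             ≤⟨ h ⟩
    c ℚ.* logGrowth m ℚ.+ d          ≤⟨ ℚₚ.+-monoˡ-≤ d (ℚₚ.*-monoˡ-≤-nonNeg c
                                          (ℚₚ.≤-trans (logGrowth-≤ m 999≤k) (logSum-mono k g≤N))) ⟩
    c ℚ.* logSum N k ℚ.+ d           ∎
    where open ℚₚ.≤-Reasoning

decide : ∀ {p q} {_ : True (p ℚ.≤? q)} → p ℚ.≤ q
decide {_} {_} {w} = toWitness w

below₁ : ∀ m → Below (+ 6114 / 10000) (+ 2158 / 1000) m
below₁ 0 = decide
below₁ 1 = decide
below₁ 2 = decide
-- The tightest case: 0.6114 · 1.38 + 2.158 is about 3.0017, against the required 3.001.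
below₁ 3 = decide
below₁ 4 = decide
below₁ (suc (suc m@(suc (suc (suc l))))) =
  below-step (+ 6114 / 10000) (+ 2158 / 1000) decide l (below₁ m)

-- With these constants the inequality fails at 3 and 4 elements, so the induction starts at 5.
below₂ : ∀ m → Below (+ 6071 / 10000) (+ 2152 / 1000) (5 ℕ.+ m)
below₂ 0 = decide
below₂ 1 = decide
below₂ (suc (suc m)) =
  below-step (+ 6071 / 10000) (+ 2152 / 1000) decide (2 ℕ.+ m) (below₂ m)

proposition2 : (n : ℤ) .{{_ : NonZero n}} →
    (fromℕ (B n) <ᵣ (+ 6114 / 10000) ·ᵣ log ∣ n ∣ +ᵣ fromℚ (+ 2158 / 1000)) ×
    (400 < ∣ n ∣ →
    fromℕ (B n) <ᵣ (+ 6071 / 10000) ·ᵣ log ∣ n ∣ +ᵣ fromℚ (+ 2152 / 1000))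
proposition2 n =
  <ᵣ-log (+ 6114 / 10000) (+ 2158 / 1000) (B n) ℕₚ.≤-refl (growth-B n) (below₁ (B n)) ,
  -- The index `5 ℕ.+ (B n ℕ.∸ 5)` is the maximum of 5 and `B n`.
  λ 400<∣n∣ → <ᵣ-log (+ 6071 / 10000) (+ 2152 / 1000) (5 ℕ.+ (B n ℕ.∸ 5))
    (ℕₚ.m≤n+m∸n (B n) 5) (growth-≤ 400<∣n∣) (below₂ (B n ℕ.∸ 5))
  where
  growth-≤ : 400 < ∣ n ∣ → growth (5 ℕ.+ (B n ℕ.∸ 5)) ℕ.≤ ∣ n ∣
  growth-≤ 400<∣n∣ with ℕₚ.≤-total 5 (B n)
  ... | inj₁ 5≤B = subst (λ m → growth m ℕ.≤ ∣ n ∣) (sym (ℕₚ.m+[n∸m]≡n 5≤B)) (growth-B n)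
  -- `growth 5` is 32 · 4 = 128, below 400.
  ... | inj₂ B≤5 = subst (λ m → growth (5 ℕ.+ m) ℕ.≤ ∣ n ∣) (sym (ℕₚ.m≤n⇒m∸n≡0 B≤5))
                     (ℕₚ.≤-trans (ℕₚ.m≤m+n 128 272) (ℕₚ.<⇒≤ 400<∣n∣))
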